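{- Let $m\ge 1$ be fixed. For every integer $K\ge 2$, under the $K$-type dyadic adversarial family on $m$ identical machines with $N=nm$ jobs, every deterministic online algorithm satisfies $$\liminf_{n\to\infty}\frac{\mathrm{ALG}}{\mathrm{OPT}}\ \ge\ \frac{3(2-4^{ -K})}{4-4^{ -K}} .$$ In particular, as $K\to\infty$, this lower bound tends to $\frac32$.
   Context: Obligatory-test scheduling on $m$ identical parallel machines: a set of jobs $J=\{1,\dots,N\}$ is available at time $0$. Each job $j$ has a test operation $\tau_j$ of known length $t_j\ge 0$ and a processing operation $\pi_j$ of initially unknown length $p_j\ge 0$. The value $p_j$ is revealed to the algorithm only when $\tau_j$ completes. The operation $\pi_j$ cannot start before $\tau_j$ has completed; it may be executed on any machine and need not start immediately after $\tau_j$. Each machine executes at most one operation at a time, operations are executed nonpreemptively, and idle time is allowed. The completion time $C_j$ is the time at which $\pi_j$ finishes, and all jobs must be completed. The objective is to minimize $\sum_j C_j$. $\mathrm{ALG}$ is the online algorithm's objective value and $\mathrm{OPT}$ is the optimal offline objective value on the same instance. The $K$-type dyadic adversarial family: there are $N=nm$ jobs, all with test time $1$, where $n$ is divisible by $2^K$ (assumed for notational simplicity, so that all type counts are integers; $n\to\infty$ along such values). A type-$i$ job, $i\in\{0,1,\dots,K\}$, has processing time $i$. The proportion of type-$i$ jobs is $\lambda_i=2^{ -(i+1)}$ for $0\le i\le K-1$ and $\lambda_K=2^{ -K}$, so $\sum_{i=0}^K\lambda_i=1$. The adversary assigns processing times dynamically according to the order in which tests complete (simultaneous ties broken arbitrarily),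 in decreasing order of processing time: the first $\lambda_K N$ jobs whose tests complete are of type $K$, the next $\lambda_{K-1}N$ are of type $K-1$, and so on, and the final $\lambda_0 N$ are of type $0$. -}

module Defs where

open import Level using (Level; _⊔_) renaming (suc to lsuc)
open import Algebra.Bundles using (CommutativeRing; Semiring)
open import Data.Nat as ℕ using (ℕ; zero; suc; _⊓_)
open import Data.Nat.Divisibility using (_∣_; divides; ∣m⇒∣m*n)
open import Data.Nat.DivMod using (m*n/n≡m)
open import Data.Fin using (Fin)
open import Data.Fin.Properties using () renaming (_≟_ to _≟ᶠ_)
open import Data.List
  using (List; []; _∷_; [_]; _++_; length; allFin; concatMap; downFrom; replicate)
open import Data.List.Properties
  using (++-assoc; ++-identityʳ; length-++; length-replicate; length-tabulate)
open import Data.List.Relation.Binary.Permutation.Propositional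
  using (_↭_; ↭-refl; ↭-sym; ↭-trans; prep; swap; ↭⇒↭ₛ)
open import Data.List.Relation.Binary.Permutation.Propositional.Properties
  using (↭-length; All-resp-↭; ++⁺ˡ)
open import Data.List.Relation.Binary.Pointwise as PW using (Pointwise; []; _∷_)
open import Data.List.Relation.Unary.All as All using (All; []; _∷_)
open import Data.List.Relation.Unary.AllPairs using (AllPairs; []; _∷_)
open import Data.List.Relation.Unary.Unique.Propositional using (Unique)
open import Data.List.Relation.Unary.Unique.Propositional.Properties using (allFin⁺)
open import Data.Product using (Σ-syntax; ∃; ∃₂; ∃-syntax; _×_; _,_; proj₁)
open import Data.Sum using (_⊎_; inj₁; inj₂)
open import Data.Vec.Functional using (updateAt)
open import Data.Vec.Functional.Properties using (updateAt-updates; updateAt-minimal)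
open import Function using (const)
open import Relation.Binary.Core using (Rel)
open import Relation.Binary.Structures using (IsDecTotalOrder)
open import Relation.Binary.PropositionalEquality as ≡
  using (_≡_; _≢_; cong; subst; module ≡-Reasoning)
open import Relation.Nullary using (¬_; yes; no; contradiction)
import Algebra.Definitions.RawSemiring as RawSemiringOps
import Algebra.Properties.Ring as RingProps
import Data.List.Relation.Binary.Permutation.Setoid.Properties as PermSetoid
import Data.List.Relation.Unary.All.Properties as All
import Data.List.Relation.Unary.AllPairs.Properties as AllPairs
import Data.Nat.Properties as ℕ
import Relation.Binary.Construct.NonStrictToStrict as ToStrict

-- The time axis. The real numbers are the intended model; since agda-stdlib has
-- none, everything is stated over an arbitrary Archimedean ordered field.
record ArchimedeanOrderedField (c ℓ₁ ℓ₂ : Level) : Set (lsuc (c ⊔ ℓ₁ ⊔ ℓ₂)) where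
  field
    commutativeRing : CommutativeRing c ℓ₁

  open CommutativeRing commutativeRing public
  open RawSemiringOps (Semiring.rawSemiring semiring) public
    using (_^_; sum) renaming (_×_ to _·_)

  infix  4 _≤_
  infix  8 _⁻¹
  infixl 7 _÷_

  field
    _≤_             : Rel Carrier ℓ₂
    isDecTotalOrder : IsDecTotalOrder _≈_ _≤_
    +-monoˡ-≤       : ∀ {x y} z → x ≤ y → x + z ≤ y + z
    *-nonNeg        : ∀ {x y} → 0# ≤ x → 0# ≤ y → 0# ≤ x * y
    0≉1             : ¬ 0# ≈ 1#
    -- Total; the value at 0# is unspecified.
    _⁻¹             : Carrier → Carrier
    ⁻¹-cong         : ∀ {x y} → x ≈ y → x ⁻¹ ≈ y ⁻¹
    ⁻¹-inverseʳ     : ∀ {x} → ¬ x ≈ 0# → x * x ⁻¹ ≈ 1#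
    archimedean     : ∀ x → ∃[ n ] x ≤ n · 1#

  open IsDecTotalOrder isDecTotalOrder public
    using (_≤?_; _≟_; total; antisym; ≤-respˡ-≈; ≤-respʳ-≈)
    renaming (refl to ≤-refl; reflexive to ≤-reflexive; trans to ≤-trans)
  open ToStrict _≈_ _≤_ public using (_<_)

  fromℕ : ℕ → Carrier
  fromℕ n = n · 1#

  _÷_ : Carrier → Carrier → Carrier
  x ÷ y = x * y ⁻¹

module Scheduling {c ℓ₁ ℓ₂} (F : ArchimedeanOrderedField c ℓ₁ ℓ₂) where

  open ArchimedeanOrderedField F

  Time : Set c
  Time = Carrier

  record Instance (N : ℕ) : Set (c ⊔ ℓ₂) where
    field
      testTime   : Fin N → Time
      procTime   : Fin N → Time
      testTime≥0 : ∀ j → 0# ≤ testTime j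
      procTime≥0 : ∀ j → 0# ≤ procTime j

  open Instance public

  data Op (N : ℕ) : Set where
    τ π : Fin N → Op N

  duration : ∀ {N} → Instance N → Op N → Time
  duration I (τ j) = testTime I j
  duration I (π j) = procTime I j

  record Schedule (m N : ℕ) : Set c where
    field
      start   : Op N → Time
      machine : Op N → Fin m

  open Schedule public

  completion : ∀ {m N} → Instance N → Schedule m N → Op N → Time
  completion I S o = start S o + duration I o

  record Feasible {m N} (I : Instance N) (S : Schedule m N) : Set (c ⊔ ℓ₂) where
    field
      start≥0     : ∀ o → 0# ≤ start S o
      testFirst   : ∀ j → completion I S (τ j) ≤ start S (π j)
      noOverlap   : ∀ {o o′} → o ≢ o′ → machine S o ≡ machine S o′ →
                    completion I S o ≤ start S o′ ⊎ completion I S o′ ≤ start S o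

  totalCompletionTime : ∀ {m N} → Instance N → Schedule m N → Time
  totalCompletionTime I S = sum (λ j → completion I S (π j))

  IsOPT : ∀ {N} (m : ℕ) → Instance N → Time → Set (c ⊔ ℓ₁ ⊔ ℓ₂)
  IsOPT {N} m I v =
      (Σ[ S ∈ Schedule m N ] Feasible I S × totalCompletionTime I S ≈ v)
    × (∀ (S : Schedule m N) → Feasible I S → v ≤ totalCompletionTime I S)

  -- A deterministic online algorithm is a map from instances to feasible
  -- schedules whose behaviour up to time θ depends only on the number of jobs,
  -- the test times, and the processing times revealed by tests completed by θ.
  record OnlineAlgorithm (m : ℕ) : Set (c ⊔ ℓ₁ ⊔ ℓ₂) where
    field
      schedule        : ∀ {N} → Instance N → Schedule m N
      feasible        : ∀ {N} (I : Instance N) → Feasible I (schedule I)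
      nonAnticipating :
        ∀ {N} (I I′ : Instance N) (θ : Time) →
        (∀ j → testTime I j ≈ testTime I′ j) →
        (∀ j → completion I (schedule I) (τ j) ≤ θ → procTime I j ≈ procTime I′ j) →
        ∀ o → start (schedule I) o ≤ θ ⊎ start (schedule I′) o ≤ θ →
        start (schedule I) o ≈ start (schedule I′) o ×
        machine (schedule I) o ≡ machine (schedule I′) o

  open OnlineAlgorithm public

  ALG : ∀ {m N} → OnlineAlgorithm m → Instance N → Time
  ALG A I = totalCompletionTime I (schedule A I)

  -- λᵢ N for 0 ≤ i ≤ K, where λᵢ = 2^-(i+1) for i < K and λ_K = 2^-K, that is,
  -- λᵢ = 2^-min(i+1,K). The division is exact whenever 2^K divides N.
  typeCount : (K N i : ℕ) → ℕ
  typeCount K N i = (N ℕ./ 2 ℕ.^ (suc i ⊓ K)) {{ℕ.m^n≢0 2 (suc i ⊓ K)}}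

  -- The types handed out by the adversary, in order of test completion:
  -- λ_K N times K, then λ_{K-1} N times K-1, …, finally λ₀ N times 0.
  dyadicTypes : (K N : ℕ) → List ℕ
  dyadicTypes K N = concatMap (λ i → replicate (typeCount K N i) i) (downFrom (suc K))

  -- I results from playing A against the adaptive adversary: under some
  -- tie-breaking, the k-th test that A completes on I reveals the k-th type.
  -- As A is non-anticipating, the instances produced by the dynamic game are
  -- exactly those that satisfy this consistency condition.
  record DyadicOutcome {m N} (A : OnlineAlgorithm m) (K : ℕ) (I : Instance N)
         : Set (c ⊔ ℓ₁ ⊔ ℓ₂) where
    field
      unitTests : ∀ j → testTime I j ≈ 1#
      order     : List (Fin N)
      allJobs   : order ↭ allFin N
      sorted    : AllPairs (λ j k → completion I (schedule A I) (τ j)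
                                  ≤ completion I (schedule A I) (τ k)) order
      types     : Pointwise (λ j i → procTime I j ≈ fromℕ i) order (dyadicTypes K N)

  -- The values of ALG/OPT attainable at n; there may be several, one for each
  -- tie-breaking, and there are none unless 2^K divides n.
  DyadicRatio : ∀ {m} → OnlineAlgorithm m → (K n : ℕ) → Time → Set (c ⊔ ℓ₁ ⊔ ℓ₂)
  DyadicRatio {m} A K n x =
    2 ℕ.^ K ∣ n ×
    (Σ[ I ∈ Instance (n ℕ.* m) ] DyadicOutcome A K I ×
      (Σ[ opt ∈ Time ] IsOPT m I opt × x ≈ ALG A I ÷ opt))

  -- lim inf_{n→∞} xₙ ≥ b for every selection xₙ with R n xₙ.
  LiminfAtLeast : ∀ {r} → (ℕ → Time → Set r) → Time → Set (c ⊔ ℓ₁ ⊔ ℓ₂ ⊔ r)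
  LiminfAtLeast R b =
    ∀ ε → 0# < ε → ∃[ n₀ ] (∀ n → n₀ ℕ.≤ n → ∀ x → R n x → b - ε ≤ x)

  TendsTo : (ℕ → Time) → Time → Set (c ⊔ ℓ₁ ⊔ ℓ₂)
  TendsTo a L =
    ∀ ε → 0# < ε → ∃[ k₀ ] (∀ k → k₀ ℕ.≤ k → L - ε < a k × a k < L + ε)

  dyadicBound : ℕ → Time
  dyadicBound K =
    (fromℕ 3 * (fromℕ 2 - (fromℕ 4 ^ K) ⁻¹)) ÷ (fromℕ 4 - (fromℕ 4 ^ K) ⁻¹)

-- Every algorithm has an outcome against the adversary (dyadicOutcome), so
-- quantifying over DyadicOutcome is never vacuous.
module OutcomeExistence {c ℓ₁ ℓ₂} (F : ArchimedeanOrderedField c ℓ₁ ℓ₂) where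

  open ArchimedeanOrderedField F
  open Scheduling F

  0≤1 : 0# ≤ 1#
  0≤1 with total 0# 1#
  ... | inj₁ p = p
  ... | inj₂ 1≤0 = ≤-respʳ-≈ -1*-1≈1 (*-nonNeg q q)
    where
      open RingProps ring
      -1*-1≈1 : - 1# * - 1# ≈ 1#
      -1*-1≈1 = trans (sym (-‿distribˡ-* 1# (- 1#))) (trans (-‿cong (*-identityˡ (- 1#))) (-‿involutive 1#))
      q : 0# ≤ - 1#
      q = ≤-respˡ-≈ (-‿inverseʳ 1#) (≤-respʳ-≈ (+-identityˡ (- 1#)) (+-monoˡ-≤ (- 1#) 1≤0))

  0≤fromℕ : ∀ n → 0# ≤ fromℕ n
  0≤fromℕ zero    = ≤-refl
  0≤fromℕ (suc n) = ≤-trans 0≤1 (≤-respˡ-≈ (+-identityˡ 1#)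
    (≤-respʳ-≈ (+-comm (fromℕ n) 1#) (+-monoˡ-≤ 1# (0≤fromℕ n))))

  +-cancelʳ-≤ : ∀ {x y} z → x + z ≤ y + z → x ≤ y
  +-cancelʳ-≤ {x} {y} z p = ≤-respˡ-≈ (e x) (≤-respʳ-≈ (e y) (+-monoˡ-≤ (- z) p))
    where
      e : ∀ x → (x + z) + - z ≈ x
      e x = trans (+-assoc x z (- z)) (trans (+-congˡ (-‿inverseʳ z)) (+-identityʳ x))

  x+1≰x : ∀ {x} → ¬ x + 1# ≤ x
  x+1≰x {x} p = 0≉1 (antisym 0≤1 (+-cancelʳ-≤ x
    (≤-respˡ-≈ (+-comm x 1#) (≤-respʳ-≈ (sym (+-identityˡ x)) p))))

  extractMin : ∀ {a} {A : Set a} (f : A → Time) x xs →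
    ∃₂ λ y ys → x ∷ xs ↭ y ∷ ys × All (λ z → f y ≤ f z) ys
  extractMin f x [] = x , [] , ↭-refl , []
  extractMin f x (x′ ∷ xs) with extractMin f x′ xs
  ... | y , ys , perm , all with total (f x) (f y)
  ...   | inj₁ x≤y = x , y ∷ ys , prep x perm , x≤y ∷ All.map (≤-trans x≤y) all
  ...   | inj₂ y≤x = y , x ∷ ys , ↭-trans (prep x perm) (swap x y ↭-refl) , y≤x ∷ all

  module Play {m N : ℕ} (A : OnlineAlgorithm m) where

    done : Instance N → Fin N → Time
    done I j = completion I (schedule A I) (τ j)

    Realised : List ℕ → Set (c ⊔ ℓ₁ ⊔ ℓ₂)
    Realised ts =
      ∃[ I ] (∀ j → testTime I j ≈ 1#) × ∃[ order ] order ↭ allFin N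
        × AllPairs (λ j k → done I j ≤ done I k) order
        × Pointwise (λ j i → procTime I j ≈ fromℕ i) order ts

    assign : Instance N → Fin N → ℕ → Instance N
    assign I j i = record
      { testTime = testTime I
      ; procTime = updateAt (procTime I) j (const (fromℕ i))
      ; testTime≥0 = testTime≥0 I
      ; procTime≥0 = nn }
      where
        nn : ∀ k → 0# ≤ updateAt (procTime I) j (const (fromℕ i)) k
        nn k with k ≟ᶠ j
        ... | yes ≡.refl = subst (0# ≤_) (≡.sym (updateAt-updates j (procTime I))) (0≤fromℕ i)
        ... | no k≢j = subst (0# ≤_) (≡.sym (updateAt-minimal k j (procTime I) k≢j)) (procTime≥0 I k)

    module _ (I : Instance N) (unit : ∀ j → testTime I j ≈ 1#) (j : Fin N) (i : ℕ) where
      I′ = assign I j i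

      private
        θ = start (schedule A I) (τ j)

        back : ∀ {x k} → x + testTime I k ≤ done I j → x ≤ θ
        back {x} {k} p = +-cancelʳ-≤ (testTime I j)
          (≤-respˡ-≈ (+-congˡ (trans (unit k) (sym (unit j)))) p)

        agree : ∀ k → done I k ≤ θ → procTime I k ≈ procTime I′ k
        agree k p with k ≟ᶠ j
        ... | yes ≡.refl = contradiction (≤-respˡ-≈ (+-congˡ (unit j)) p) x+1≰x
        ... | no k≢j = reflexive (≡.sym (updateAt-minimal k j (procTime I) k≢j))

        same : ∀ k → start (schedule A I) (τ k) ≤ θ ⊎ start (schedule A I′) (τ k) ≤ θ →
               done I k ≈ done I′ k
        same k p = +-congʳ (proj₁ (nonAnticipating A I I′ θ (λ _ → refl) agree (τ k) p))

      early : ∀ k → done I k ≤ done I j → done I k ≈ done I′ k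
      early k p = same k (inj₁ (back {k = k} p))

      late : ∀ k → done I j ≤ done I k → done I j ≤ done I′ k
      late k p with total (done I j) (done I′ k)
      ... | inj₁ q = q
      ... | inj₂ q = ≤-respʳ-≈ (same k (inj₂ (back {k = k} q))) p

    -- The dynamic game: js have been tested and carry the types is, rest is
    -- still to be tested, ts are the types still to be handed out. Each round
    -- fixes the earliest remaining test; by causality (early, late) this
    -- leaves the past of the schedule intact.
    play : (I : Instance N) → (∀ j → testTime I j ≈ 1#) →
           ∀ js rest is ts → length rest ≡ length ts →
           AllPairs (λ j k → done I j ≤ done I k) js →
           All (λ j → All (λ k → done I j ≤ done I k) rest) js →
           Pointwise (λ j i → procTime I j ≈ fromℕ i) js is →
           Unique (js ++ rest) → js ++ rest ↭ allFin N →
           Realised (is ++ ts)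
    play I u js [] is [] _ srt _ pw _ perm =
      I , u , js , subst (_↭ allFin N) (++-identityʳ js) perm , srt
        , subst (Pointwise _ js) (≡.sym (++-identityʳ is)) pw
    play I u js (r ∷ rs) is (t ∷ ts) len srt low pw uniq perm
      with extractMin (done I) r rs
    ... | j , rest , rperm , jmin =
      subst Realised (++-assoc is [ t ] ts)
        (play J u (js ++ [ j ]) rest (is ++ [ t ]) ts
          (ℕ.suc-injective (≡.trans (≡.sym (↭-length rperm)) len))
          srt′ low′ pw′ uniq′ perm′)
      where
        J = assign I j t
        low₁ : All (λ k → All (λ l → done I k ≤ done I l) (j ∷ rest)) js
        low₁ = All.map (All-resp-↭ rperm) low
        ≤j : All (λ k → done I k ≤ done I j) js
        ≤j = All.map (λ { (p ∷ _) → p }) low₁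
        keep : ∀ {k} → done I k ≤ done I j → done I k ≈ done J k
        keep = early I u j t _
        e-j = keep ≤-refl
        srt₀ : ∀ {xs} → All (λ k → done I k ≤ done I j) xs →
               AllPairs (λ j k → done I j ≤ done I k) xs → AllPairs (λ j k → done J j ≤ done J k) xs
        srt₀ [] [] = []
        srt₀ (p ∷ ps) (a ∷ as) = All.zipWith (λ (q , r) → ≤-respˡ-≈ (keep p) (≤-respʳ-≈ (keep q) r)) (ps , a) ∷ srt₀ ps as
        srt′ = AllPairs.++⁺ (srt₀ ≤j srt) ([] ∷ [])
                 (All.map (λ p → ≤-respˡ-≈ (keep p) (≤-respʳ-≈ e-j p) ∷ []) ≤j)
        lateRest : All (λ l → done I j ≤ done J l) rest
        lateRest = All.map (late I u j t _) jmin
        low′ = All.++⁺ (All.map (λ p → All.map (λ q → ≤-respˡ-≈ (keep p) (≤-trans p q)) lateRest) ≤j)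
                       (All.map (≤-respˡ-≈ e-j) lateRest ∷ [])
        step↭ : js ++ (r ∷ rs) ↭ (js ++ [ j ]) ++ rest
        step↭ = subst (js ++ (r ∷ rs) ↭_) (≡.sym (++-assoc js [ j ] rest)) (++⁺ˡ js rperm)
        uniq′ : Unique ((js ++ [ j ]) ++ rest)
        uniq′ = PermSetoid.Unique-resp-↭ (≡.setoid _) (↭⇒↭ₛ step↭) uniq
        perm′ = ↭-trans (↭-sym step↭) perm
        j∉ : All (_≢ j) js
        j∉ = All.map (λ { (p ∷ _) → p }) (split js uniq₀)
          where
            uniq₀ : Unique (js ++ (j ∷ rest))
            uniq₀ = subst Unique (++-assoc js [ j ] rest) uniq′
            split : ∀ xs {ys} → Unique (xs ++ ys) → All (λ x → All (x ≢_) ys) xs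
            split [] _ = []
            split (x ∷ xs) (a ∷ u) = All.++⁻ʳ xs a ∷ split xs u
        pw₀ : ∀ {xs is} → All (_≢ j) xs → Pointwise (λ j i → procTime I j ≈ fromℕ i) xs is →
              Pointwise (λ j i → procTime J j ≈ fromℕ i) xs is
        pw₀ [] [] = []
        pw₀ (n ∷ ns) (e ∷ es) = trans (reflexive (updateAt-minimal _ j (procTime I) n)) e ∷ pw₀ ns es
        pw′ = PW.++⁺ (pw₀ j∉ pw) (reflexive (updateAt-updates j (procTime I)) ∷ [])

    anyTypes : ∀ ts → length ts ≡ N → Realised ts
    anyTypes ts len = play I₀ (λ _ → refl) [] (allFin N) [] ts
        (≡.trans (length-tabulate {n = N} (λ i → i)) (≡.sym len)) [] [] [] (allFin⁺ N) ↭-refl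
      where
        I₀ : Instance N
        I₀ = record { testTime = λ _ → 1# ; procTime = λ _ → 0#
                    ; testTime≥0 = λ _ → 0≤1 ; procTime≥0 = λ _ → ≤-refl }

  exact : ∀ K q i e → suc i ⊓ K ≡ e → ∀ r → r ℕ.* 2 ℕ.^ e ≡ q → typeCount K q i ≡ r
  exact K _ i _ ≡.refl r ≡.refl = m*n/n≡m r (2 ℕ.^ (suc i ⊓ K)) {{ℕ.m^n≢0 2 (suc i ⊓ K)}}

  lower : ∀ K q i d → i ℕ.+ d ≡ K →
    length (concatMap (λ i → replicate (typeCount K (q ℕ.* 2 ℕ.^ K) i) i) (downFrom i)) ℕ.+ q ℕ.* 2 ℕ.^ d ≡ q ℕ.* 2 ℕ.^ K
  lower K q zero d ≡.refl = ≡.refl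
  lower K q (suc i) d eq = begin
    length (replicate n₀ i ++ R) ℕ.+ D ≡⟨ cong (ℕ._+ D) (≡.trans (length-++ (replicate n₀ i)) (cong (ℕ._+ length R) (length-replicate n₀))) ⟩
    n₀ ℕ.+ length R ℕ.+ D ≡⟨ cong (λ z → z ℕ.+ length R ℕ.+ D) n₀≡ ⟩
    D ℕ.+ length R ℕ.+ D ≡⟨ cong (ℕ._+ D) (ℕ.+-comm D (length R)) ⟩
    length R ℕ.+ D ℕ.+ D ≡⟨ ℕ.+-assoc (length R) D D ⟩
    length R ℕ.+ (D ℕ.+ D) ≡⟨ cong (length R ℕ.+_) dd ⟩
    length R ℕ.+ q ℕ.* 2 ℕ.^ suc d ≡⟨ lower K q i (suc d) (≡.trans (ℕ.+-suc i d) eq) ⟩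
    q ℕ.* 2 ℕ.^ K ∎
    where
      open ≡-Reasoning
      n₀ = typeCount K (q ℕ.* 2 ℕ.^ K) i
      D = q ℕ.* 2 ℕ.^ d
      R = concatMap (λ i → replicate (typeCount K (q ℕ.* 2 ℕ.^ K) i) i) (downFrom i)
      dd : D ℕ.+ D ≡ q ℕ.* 2 ℕ.^ suc d
      dd = ≡.sym (≡.trans (cong (q ℕ.*_) (cong (2 ℕ.^ d ℕ.+_) (ℕ.+-identityʳ _))) (ℕ.*-distribˡ-+ q (2 ℕ.^ d) (2 ℕ.^ d)))
      n₀≡ : n₀ ≡ D
      n₀≡ = exact K _ i (suc i) (ℕ.m≤n⇒m⊓n≡m (subst (suc i ℕ.≤_) eq (ℕ.m≤m+n (suc i) d))) D
        (≡.trans (ℕ.*-assoc q _ _) (cong (q ℕ.*_) (≡.trans (ℕ.*-comm (2 ℕ.^ d) _)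
          (≡.trans (≡.sym (ℕ.^-distribˡ-+-* 2 (suc i) d)) (cong (2 ℕ.^_) eq)))))

  length-dyadicTypes : ∀ K N → 2 ℕ.^ K ∣ N → length (dyadicTypes K N) ≡ N
  length-dyadicTypes K _ (divides q ≡.refl) = begin
    length (replicate n₀ K ++ R) ≡⟨ ≡.trans (length-++ (replicate n₀ K)) (cong (ℕ._+ length R) (length-replicate n₀)) ⟩
    n₀ ℕ.+ length R ≡⟨ ℕ.+-comm n₀ _ ⟩
    length R ℕ.+ n₀ ≡⟨ cong (length R ℕ.+_) (≡.trans (exact K _ K K (ℕ.m≥n⇒m⊓n≡n (ℕ.n≤1+n K)) q ≡.refl) (≡.sym (ℕ.*-identityʳ q))) ⟩
    length R ℕ.+ q ℕ.* 2 ℕ.^ 0 ≡⟨ lower K q K 0 (ℕ.+-identityʳ K) ⟩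
    q ℕ.* 2 ℕ.^ K ∎
    where
      open ≡-Reasoning
      n₀ = typeCount K (q ℕ.* 2 ℕ.^ K) K
      R = concatMap (λ i → replicate (typeCount K (q ℕ.* 2 ℕ.^ K) i) i) (downFrom K)

  dyadicOutcome : ∀ {m} (A : OnlineAlgorithm m) K n → 2 ℕ.^ K ∣ n →
                  ∃ λ (I : Instance (n ℕ.* m)) → DyadicOutcome A K I
  dyadicOutcome {m} A K n 2^K∣n
    with Play.anyTypes A (dyadicTypes K (n ℕ.* m)) (length-dyadicTypes K (n ℕ.* m) (∣m⇒∣m*n m 2^K∣n))
  ... | I , u , order , perm , srt , pw = I , record
    { unitTests = u ; order = order ; allJobs = perm ; sorted = srt ; types = pw }

module Submission where

-- By the time T at most m T units of work are finished on m machines, so m Σ C_k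
-- is at least the total length of the operations finished by C_k, summed over all
-- jobs k. The sum is estimated over unordered pairs of jobs: if j is tested before
-- k and p_j ≥ p_k, the test of j delays k, and either π_j delays k or both
-- operations of k delay j, so that the pair contributes at least
-- 1 + min(p_j , 1 + p_k). On the dyadic family this is 1 + min + [p_j ≠ p_k], while
-- shortest processing time first pays 1 + min for a pair of jobs on the same
-- machine, up to terms linear in n. Passing from K to K + 1 shifts all types by one
-- and doubles the family by jobs of type 0, so both pair sums are geometric in K.

open import Defs
open import Data.Bool using (Bool; false; if_then_else_; true)
open import Data.Fin as Fin using (zero; suc; Fin; _↑ʳ_; _↑ˡ_; combine; quotient; remainder)
open import Data.Fin.Permutation
  using (Permutation′; _⟨$⟩ʳ_; _⟨$⟩ˡ_; inverseʳ; inverseˡ; permutation)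
open import Data.Fin.Properties
  using (combine-remQuot; remQuot-combine; splitAt-↑ʳ)
  renaming (<-cmp to <ᶠ-cmp; _≟_ to _≟ᶠ_)
open import Data.List
  using (List; []; _++_; _∷_; allFin; concatMap; downFrom; filter; length; lookup; map;
    replicate; tabulate)
open import Data.List.Membership.Propositional.Properties using (∈-allFin; ∈-tabulate⁻)
open import Data.List.Properties
  using (++-assoc; ++-identityʳ; concatMap-++; concatMap-cong; concatMap-map; length-++;
    length-filter; length-map; length-replicate; length-tabulate; map-++; map-concatMap;
    map-cong; map-replicate; map-tabulate; map-∘; tabulate-cong; tabulate-lookup)
open import Data.List.Relation.Binary.Permutation.Propositional using (_↭_; ↭-sym; ↭⇒↭ₛ)
open import Data.List.Relation.Binary.Permutation.Propositional.Properties
  using (↭-length; ∈-resp-↭)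
open import Data.List.Relation.Binary.Pointwise as Pointwise using (Pointwise)
open import Data.List.Relation.Unary.All as All using (All; []; _∷_)
open import Data.List.Relation.Unary.AllPairs as AllPairs using (AllPairs; []; _∷_)
open import Data.List.Relation.Unary.Unique.Propositional using (Unique)
open import Data.Nat as ℕ using (ℕ; zero; suc)
open import Data.Nat.DivMod using (m*n/m*o≡n/o; m*n/n≡m)
open import Data.Nat.Divisibility using (divides)
open import Data.Nat.ListAction.Properties using (sum-++)
open import Data.Nat.Tactic.RingSolver using (solve-∀)
open import Data.Product using (_,_; _×_; proj₁; proj₂; ∃; ∃-syntax)
open import Data.Sum using (_⊎_; inj₁; inj₂)
open import Function using (_∘_)
open import Relation.Binary.Bundles using (Poset)
open import Relation.Binary.Definitions using (tri<; tri>; tri≈)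
open import Relation.Binary.PropositionalEquality as ≡ using (_≡_; _≢_; cong; cong₂; subst)
open import Relation.Binary.Structures using (IsDecTotalOrder)
open import Relation.Nullary using (contradiction; does; no; ¬?; ¬_)
open import Relation.Nullary.Decidable using (dec-true)
open import Relation.Unary using (Decidable)
import Algebra.Properties.Ring
import Algebra.Properties.Semiring.Mult
import Algebra.Properties.Semiring.Sum
import Algebra.Solver.Ring.NaturalCoefficients.Default
import Data.List.Relation.Binary.Permutation.Setoid.Properties as PermSetoid
import Data.List.Relation.Unary.All.Properties as All
import Data.List.Relation.Unary.AllPairs.Properties as AllPairs
import Data.List.Relation.Unary.Unique.Propositional.Properties as Unique
import Data.Nat.ListAction as ListAction
import Data.Nat.Properties as ℕ
import Relation.Binary.Reasoning.PartialOrder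

-- Nothing is known about where or when an algorithm runs an operation: the two operations of a job
-- may sit on different machines, machines may idle, and jobs of type 0 have processing operations
-- of length 0. The load bound survives all this because it rests only on disjointness within each
-- machine; taken at every completion time and summed, it leaves an estimate about pairs of jobs in
-- which no machine occurs. Decreasing types hurt the algorithm because the test of a longer job
-- always comes before that of a shorter one. One doubling adds 6n² to the pair sum forced on the
-- algorithm and 4n² to that of the reference schedule, n being the size before the doubling; the
-- quotient of these increments is the limit 3/2. Both sums start from the same value at K = 0, and
-- this common start is the origin of the terms 4^-K in the bound.

module _ {a} {A : Set a} where

  -- Lists: repeated entries and tabulation.

  replicate-+ : ∀ m n (x : A) → replicate (m ℕ.+ n) x ≡ replicate m x ++ replicate n x
  replicate-+ zero    n x = ≡.refl
  replicate-+ (suc m) n x = cong (x ∷_) (replicate-+ m n x)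

  replicate-* : ∀ n m (x : A) → replicate (n ℕ.* m) x ≡ concatMap (replicate m) (replicate n x)
  replicate-* zero    m x = ≡.refl
  replicate-* (suc n) m x =
    ≡.trans (replicate-+ m (n ℕ.* m) x) (cong (replicate m x ++_) (replicate-* n m x))

  tabulate-const : ∀ n (x : A) → tabulate {n = n} (λ _ → x) ≡ replicate n x
  tabulate-const zero    x = ≡.refl
  tabulate-const (suc n) x = cong (x ∷_) (tabulate-const n x)

  tabulate-+ : ∀ m {n} (f : Fin (m ℕ.+ n) → A) →
               tabulate f ≡ tabulate (f ∘ (_↑ˡ n)) ++ tabulate (f ∘ (m ↑ʳ_))
  tabulate-+ zero    f = ≡.refl
  tabulate-+ (suc m) f = cong (f zero ∷_) (tabulate-+ m (f ∘ suc))

  -- Reading a position as a pair (`quotient`, `remainder`) cuts the positions into consecutive runs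
  -- of length m. Later the quotient is a place on a machine and the remainder names the machine.
  tabulate-quotient : ∀ {n} m (t : Fin n → A) →
                      tabulate (t ∘ quotient m) ≡ concatMap (replicate m) (tabulate t)
  tabulate-quotient {zero}  m t = ≡.refl
  tabulate-quotient {suc n} m t =
    ≡.trans (tabulate-+ m (t ∘ quotient m)) (cong₂ _++_
      (≡.trans (tabulate-cong (λ r → cong (t ∘ proj₁) (remQuot-combine {suc n} zero r)))
               (tabulate-const m (t zero)))
      (≡.trans (tabulate-cong (cong t ∘ quotient-↑ʳ)) (tabulate-quotient m (t ∘ suc))))
    where
      quotient-↑ʳ : ∀ x → quotient {suc n} m (m ↑ʳ x) ≡ suc (quotient {n} m x)
      quotient-↑ʳ x rewrite splitAt-↑ʳ m (n ℕ.* m) x = ≡.refl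

  ≡-tabulate : ∀ {n} (xs : List A) → length xs ≡ n → ∃ λ (f : Fin n → A) → xs ≡ tabulate f
  ≡-tabulate xs ≡.refl = lookup xs , ≡.sym (tabulate-lookup xs)

  AllPairs-tabulate⁻ : ∀ {ℓ} {R : A → A → Set ℓ} {n} {f : Fin n → A} → AllPairs R (tabulate f) →
                       ∀ {i j} → i Fin.< j → R (f i) (f j)
  AllPairs-tabulate⁻ (r ∷ _)  {zero}  {suc j} _           = All.tabulate⁻ r j
  AllPairs-tabulate⁻ (_ ∷ rs) {suc i} {suc j} (ℕ.s≤s i<j) = AllPairs-tabulate⁻ rs i<j

-- Pair sums in the natural numbers.

module _ where
  open ListAction using (sum)
  open import Data.Nat using (_+_; _*_; _^_; _≤_; _<_; _≥_; z≤n; s≤s)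
  open ≡.≡-Reasoning

  sum-map-replicate : ∀ {a} {A : Set a} (f : A → ℕ) n x → sum (map f (replicate n x)) ≡ n * f x
  sum-map-replicate f zero    x = ≡.refl
  sum-map-replicate f (suc n) x = cong (f x +_) (sum-map-replicate f n x)

  sum-map-+ : ∀ {a} {A : Set a} (f g : A → ℕ) xs →
              sum (map (λ x → f x + g x) xs) ≡ sum (map f xs) + sum (map g xs)
  sum-map-+ f g []       = ≡.refl
  sum-map-+ f g (x ∷ xs) rewrite sum-map-+ f g xs = shuffle (f x) (g x) _ _
    where
      shuffle : ∀ a b c d → a + b + (c + d) ≡ a + c + (b + d)
      shuffle = solve-∀

  sum-map-const : ∀ {a} {A : Set a} c (xs : List A) → sum (map (λ _ → c) xs) ≡ length xs * c
  sum-map-const c []       = ≡.refl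
  sum-map-const c (x ∷ xs) = cong (c +_) (sum-map-const c xs)

  sum-concatMap-replicate : ∀ m xs → sum (concatMap (replicate m) xs) ≡ m * sum xs
  sum-concatMap-replicate m []       = ≡.sym (ℕ.*-zeroʳ m)
  sum-concatMap-replicate m (x ∷ xs) = begin
    sum (replicate m x ++ concatMap (replicate m) xs)       ≡⟨ sum-++ (replicate m x) _ ⟩
    sum (replicate m x) + sum (concatMap (replicate m) xs)  ≡⟨ cong₂ _+_ (sum-replicate m) (sum-concatMap-replicate m xs) ⟩
    m * x + m * sum xs                                      ≡⟨ ≡.sym (ℕ.*-distribˡ-+ m x (sum xs)) ⟩
    m * (x + sum xs)                                        ∎
    where
      sum-replicate : ∀ k → sum (replicate k x) ≡ k * x
      sum-replicate zero    = ≡.refl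
      sum-replicate (suc k) = cong (x +_) (sum-replicate k)

  -- 1 + min(a,b), plus d when a ≠ b.
  pairCost : ℕ → ℕ → ℕ → ℕ
  pairCost d zero    zero    = 1
  pairCost d zero    (suc _) = suc d
  pairCost d (suc _) zero    = suc d
  pairCost d (suc a) (suc b) = suc (pairCost d a b)

  pairCost-comm : ∀ d a b → pairCost d a b ≡ pairCost d b a
  pairCost-comm d zero    zero    = ≡.refl
  pairCost-comm d zero    (suc _) = ≡.refl
  pairCost-comm d (suc _) zero    = ≡.refl
  pairCost-comm d (suc a) (suc b) = cong suc (pairCost-comm d a b)

  pairCost-diag : ∀ d a → pairCost d a a ≡ suc a
  pairCost-diag d zero    = ≡.refl
  pairCost-diag d (suc a) = cong suc (pairCost-diag d a)

  pairCost-> : ∀ d {a b} → b < a → pairCost d a b ≡ suc d + b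
  pairCost-> d {suc a} {zero}  _         = ≡.sym (ℕ.+-identityʳ (suc d))
  pairCost-> d {suc a} {suc b} (s≤s b<a) = ≡.trans (cong suc (pairCost-> d b<a)) (≡.sym (ℕ.+-suc (suc d) b))

  pairCost₀-≥ : ∀ {a b} → b ≤ a → pairCost 0 a b ≡ suc b
  pairCost₀-≥ {zero}  {zero}  _         = ≡.refl
  pairCost₀-≥ {suc a} {zero}  _         = ≡.refl
  pairCost₀-≥ {suc a} {suc b} (s≤s b≤a) = cong suc (pairCost₀-≥ b≤a)

  rowCost : ℕ → ℕ → List ℕ → ℕ
  rowCost d a xs = sum (map (pairCost d a) xs)

  -- The sum runs over ordered pairs, diagonal included, so that it is symmetric under reindexing.
  -- Each unordered pair counts twice, which explains the factor 2 in the estimates that use it.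
  totalPairCost : ℕ → List ℕ → ℕ
  totalPairCost d xs = sum (map (λ a → rowCost d a xs) xs)

  -- The adversary's list for Q jobs of the top type K, built up from the lowest type: this
  -- recursion exposes the shift and the doubling, which the description by proportions hides.
  ladder : ℕ → ℕ → List ℕ
  ladder zero    Q = replicate Q 0
  ladder (suc K) Q = map suc (ladder K Q) ++ replicate (Q * 2 ^ K) 0

  sum-map-ladder : ∀ (f : ℕ → ℕ) K Q → sum (map f (ladder (suc K) Q)) ≡
                   sum (map (f ∘ suc) (ladder K Q)) + Q * 2 ^ K * f 0
  sum-map-ladder f K Q = begin
    sum (map f (map suc L ++ Z))              ≡⟨ cong sum (map-++ f (map suc L) Z) ⟩
    sum (map f (map suc L) ++ map f Z)        ≡⟨ sum-++ (map f (map suc L)) _ ⟩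
    sum (map f (map suc L)) + sum (map f Z)   ≡⟨ cong₂ _+_ (cong sum (≡.sym (map-∘ L))) (sum-map-replicate f (Q * 2 ^ K) 0) ⟩
    sum (map (f ∘ suc) L) + Q * 2 ^ K * f 0   ∎
    where
      L = ladder K Q
      Z = replicate (Q * 2 ^ K) 0

  length-ladder : ∀ K Q → length (ladder K Q) ≡ Q * 2 ^ K
  length-ladder zero    Q = ≡.trans (length-replicate Q) (≡.sym (ℕ.*-identityʳ Q))
  length-ladder (suc K) Q = begin
    length (map suc (ladder K Q) ++ Z)        ≡⟨ length-++ (map suc (ladder K Q)) ⟩
    length (map suc (ladder K Q)) + length Z  ≡⟨ cong₂ _+_ (≡.trans (length-map suc (ladder K Q)) (length-ladder K Q)) (length-replicate (Q * 2 ^ K)) ⟩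
    Q * 2 ^ K + Q * 2 ^ K                     ≡⟨ double Q (2 ^ K) ⟩
    Q * 2 ^ suc K                             ∎
    where
      Z = replicate (Q * 2 ^ K) 0
      double : ∀ q e → q * e + q * e ≡ q * (2 * e)
      double = solve-∀

  sorted-ladder : ∀ K Q → AllPairs _≥_ (ladder K Q)
  sorted-ladder zero    Q = AllPairs-replicate Q
    where
      AllPairs-replicate : ∀ n → AllPairs _≥_ (replicate n 0)
      AllPairs-replicate zero    = []
      AllPairs-replicate (suc n) = All.replicate⁺ n z≤n ∷ AllPairs-replicate n
  sorted-ladder (suc K) Q = AllPairs.++⁺
    (AllPairs.map⁺ (AllPairs.map s≤s (sorted-ladder K Q)))
    (sorted-ladder zero (Q * 2 ^ K))
    (All.universal (λ _ → All.replicate⁺ (Q * 2 ^ K) z≤n) (map suc (ladder K Q)))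

  rowCost-suc : ∀ d a K Q → let n = Q * 2 ^ K in
                rowCost d (suc a) (ladder (suc K) Q) ≡ (n + n * suc d) + rowCost d a (ladder K Q)
  rowCost-suc d a K Q = begin
    rowCost d (suc a) (ladder (suc K) Q)
      ≡⟨ sum-map-ladder (pairCost d (suc a)) K Q ⟩
    sum (map (λ b → 1 + pairCost d a b) L) + n * suc d
      ≡⟨ cong (_+ n * suc d) (sum-map-+ (λ _ → 1) (pairCost d a) L) ⟩
    sum (map (λ _ → 1) L) + rowCost d a L + n * suc d
      ≡⟨ cong (λ z → z + rowCost d a L + n * suc d) (≡.trans (sum-map-const 1 L) (≡.trans (ℕ.*-identityʳ _) (length-ladder K Q))) ⟩
    n + rowCost d a L + n * suc d
      ≡⟨ shuffle n (rowCost d a L) (n * suc d) ⟩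
    (n + n * suc d) + rowCost d a L ∎
    where
      n = Q * 2 ^ K
      L = ladder K Q
      shuffle : ∀ a b c → a + b + c ≡ a + c + b
      shuffle = solve-∀

  rowCost-zero : ∀ d K Q → let n = Q * 2 ^ K in
                 rowCost d 0 (ladder (suc K) Q) ≡ n * suc d + n
  rowCost-zero d K Q = ≡.trans (sum-map-ladder (pairCost d 0) K Q) (cong₂ _+_
    (≡.trans (sum-map-const (suc d) (ladder K Q)) (cong (_* suc d) (length-ladder K Q)))
    (ℕ.*-identityʳ _))

  -- Of the 4n² ordered pairs, the n² shifted ones cost one more than before, the 2n² pairs of a
  -- positive type with a zero cost `suc d` each, and the n² pairs of zeros cost 1: the increment is
  -- n² (1 + 2 (1 + d) + 1).
  totalPairCost-suc : ∀ d K Q → let n = Q * 2 ^ K in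
    totalPairCost d (ladder (suc K) Q) ≡ totalPairCost d (ladder K Q) + (4 + 2 * d) * (n * n)
  totalPairCost-suc d K Q = begin
    totalPairCost d L′
      ≡⟨ sum-map-ladder (λ a → rowCost d a L′) K Q ⟩
    sum (map (λ a → rowCost d (suc a) L′) L) + n * rowCost d 0 L′
      ≡⟨ cong₂ (λ x y → sum x + n * y) (map-cong (λ a → rowCost-suc d a K Q) L) (rowCost-zero d K Q) ⟩
    sum (map (λ a → c + rowCost d a L) L) + n * (n * suc d + n)
      ≡⟨ cong (_+ n * (n * suc d + n)) (sum-map-+ (λ _ → c) (λ a → rowCost d a L) L) ⟩
    sum (map (λ _ → c) L) + totalPairCost d L + n * (n * suc d + n)
      ≡⟨ cong (λ z → z + totalPairCost d L + n * (n * suc d + n)) (≡.trans (sum-map-const c L) (cong (_* c) (length-ladder K Q))) ⟩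
    n * c + totalPairCost d L + n * (n * suc d + n)
      ≡⟨ collect n d (totalPairCost d L) ⟩
    totalPairCost d L + (4 + 2 * d) * (n * n) ∎
    where
      n = Q * 2 ^ K
      c = n + n * suc d
      L = ladder K Q
      L′ = ladder (suc K) Q
      collect : ∀ n d x → n * (n + n * suc d) + x + n * (n * suc d + n) ≡ x + (4 + 2 * d) * (n * n)
      collect = solve-∀

  4^≡2^*2^ : ∀ K → 4 ^ K ≡ 2 ^ K * 2 ^ K
  4^≡2^*2^ zero    = ≡.refl
  4^≡2^*2^ (suc K) = ≡.trans (cong (4 *_) (4^≡2^*2^ K)) (eq (2 ^ K))
    where
      eq : ∀ e → 4 * (e * e) ≡ 2 * e * (2 * e)
      eq = solve-∀

  -- The increments form a geometric series with ratio 4, whose sum has the denominator 3.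
  -- Multiplying by 3 and moving the negative term to the left keeps the closed form within the
  -- natural numbers.
  totalPairCost-ladder : ∀ d K Q →
    3 * totalPairCost d (ladder K Q) + (1 + 2 * d) * (Q * Q) ≡ (4 + 2 * d) * (4 ^ K * (Q * Q))
  totalPairCost-ladder d zero Q = begin
    3 * totalPairCost d (replicate Q 0) + (1 + 2 * d) * (Q * Q)
      ≡⟨ cong (λ z → 3 * z + (1 + 2 * d) * (Q * Q)) (≡.trans (sum-map-replicate (λ a → rowCost d a (replicate Q 0)) Q 0)
           (cong (Q *_) (sum-map-replicate (pairCost d 0) Q 0))) ⟩
    3 * (Q * (Q * 1)) + (1 + 2 * d) * (Q * Q)
      ≡⟨ collect d Q ⟩
    (4 + 2 * d) * (1 * (Q * Q)) ∎
    where
      collect : ∀ d Q → 3 * (Q * (Q * 1)) + (1 + 2 * d) * (Q * Q) ≡ (4 + 2 * d) * (1 * (Q * Q))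
      collect = solve-∀
  totalPairCost-ladder d (suc K) Q = begin
    3 * totalPairCost d (ladder (suc K) Q) + s
      ≡⟨ cong (λ z → 3 * z + s) (totalPairCost-suc d K Q) ⟩
    3 * (P + (4 + 2 * d) * (Q * 2 ^ K * (Q * 2 ^ K))) + s
      ≡⟨ split P s d Q (2 ^ K) ⟩
    (3 * P + s) + 3 * ((4 + 2 * d) * (2 ^ K * 2 ^ K * (Q * Q)))
      ≡⟨ cong₂ (λ x y → x + 3 * ((4 + 2 * d) * (y * (Q * Q)))) (totalPairCost-ladder d K Q) (≡.sym (4^≡2^*2^ K)) ⟩
    (4 + 2 * d) * (4 ^ K * (Q * Q)) + 3 * ((4 + 2 * d) * (4 ^ K * (Q * Q)))
      ≡⟨ collect (4 ^ K) d Q ⟩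
    (4 + 2 * d) * (4 ^ suc K * (Q * Q)) ∎
    where
      P = totalPairCost d (ladder K Q)
      s = (1 + 2 * d) * (Q * Q)
      split : ∀ p s d q e → 3 * (p + (4 + 2 * d) * (q * e * (q * e))) + s ≡
                            (3 * p + s) + 3 * ((4 + 2 * d) * (e * e * (q * q)))
      split = solve-∀
      collect : ∀ x d q → (4 + 2 * d) * (x * (q * q)) + 3 * ((4 + 2 * d) * (x * (q * q))) ≡
                          (4 + 2 * d) * (4 * x * (q * q))
      collect = solve-∀

  -- A doubling step replaces the mean type μ by (μ + 1)/2, so it never exceeds 1. A crude estimate
  -- suffices because this sum only enters the term linear in n.
  sum-suc-ladder : ∀ K Q → sum (map suc (ladder K Q)) ≤ 2 * (Q * 2 ^ K)
  sum-suc-ladder zero Q = ℕ.≤-trans (ℕ.≤-reflexive (sum-map-replicate suc Q 0)) (ℕ.m≤n*m (Q * 1) 2)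
  sum-suc-ladder (suc K) Q = ≤.begin
    sum (map suc (ladder (suc K) Q))                    ≤.≡⟨ sum-map-ladder suc K Q ⟩
    sum (map (λ x → 1 + suc x) L) + n * 1               ≤.≡⟨ cong (_+ n * 1) (sum-map-+ (λ _ → 1) suc L) ⟩
    sum (map (λ _ → 1) L) + sum (map suc L) + n * 1     ≤.≡⟨ cong (λ z → z + sum (map suc L) + n * 1) ones ⟩
    n + sum (map suc L) + n * 1                         ≤.≤⟨ ℕ.+-monoˡ-≤ (n * 1) (ℕ.+-monoʳ-≤ n (sum-suc-ladder K Q)) ⟩
    n + 2 * n + n * 1                                   ≤.≡⟨ collect Q (2 ^ K) ⟩
    2 * (Q * 2 ^ suc K)                                 ≤.∎
    where
      module ≤ = ℕ.≤-Reasoning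
      n = Q * 2 ^ K
      L = ladder K Q
      ones : sum (map (λ _ → 1) L) ≡ n
      ones = ≡.trans (sum-map-const 1 L) (≡.trans (ℕ.*-identityʳ _) (length-ladder K Q))
      collect : ∀ q e → q * e + 2 * (q * e) + q * e * 1 ≡ 2 * (q * (2 * e))
      collect = solve-∀

  -- The whole family consists of m equal copies of the family for one machine, with equal types
  -- adjacent, so the reference schedule can give every machine the same list.
  ladder-* : ∀ K Q m → ladder K (Q * m) ≡ concatMap (replicate m) (ladder K Q)
  ladder-* zero    Q m = replicate-* Q m 0
  ladder-* (suc K) Q m = begin
    map suc (ladder K (Q * m)) ++ replicate (Q * m * 2 ^ K) 0
      ≡⟨ cong₂ (λ xs k → map suc xs ++ replicate k 0) (ladder-* K Q m) (swap Q m (2 ^ K)) ⟩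
    map suc (concatMap (replicate m) L) ++ replicate (Q * 2 ^ K * m) 0
      ≡⟨ cong₂ _++_ map-suc (replicate-* (Q * 2 ^ K) m 0) ⟩
    concatMap (replicate m) (map suc L) ++ concatMap (replicate m) (replicate (Q * 2 ^ K) 0)
      ≡⟨ ≡.sym (concatMap-++ (replicate m) (map suc L) _) ⟩
    concatMap (replicate m) (ladder (suc K) Q) ∎
    where
      L = ladder K Q
      swap : ∀ q m e → q * m * e ≡ q * e * m
      swap = solve-∀
      map-suc : map suc (concatMap (replicate m) L) ≡ concatMap (replicate m) (map suc L)
      map-suc = ≡.trans (map-concatMap suc (replicate m) L)
        (≡.trans (concatMap-cong (map-replicate suc m) L) (≡.sym (concatMap-map (replicate m) suc L)))

  blocks : (ℕ → ℕ) → ℕ → List ℕ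
  blocks c k = concatMap (λ i → replicate (c i) i) (downFrom k)

  -- `downFrom` exposes the highest type first, whereas `ladder` recurses on the lowest; peeling the
  -- block of zeros off the far end reconciles the two.
  blocks-suc : ∀ c k → blocks c (suc k) ≡ map suc (blocks (c ∘ suc) k) ++ replicate (c 0) 0
  blocks-suc c zero    = ++-identityʳ (replicate (c 0) 0)
  blocks-suc c (suc k) = begin
    replicate (c (suc k)) (suc k) ++ blocks c (suc k)
      ≡⟨ cong₂ _++_ (≡.sym (map-replicate suc (c (suc k)) k)) (blocks-suc c k) ⟩
    map suc R ++ (map suc (blocks (c ∘ suc) k) ++ replicate (c 0) 0)
      ≡⟨ ≡.sym (++-assoc (map suc R) _ _) ⟩
    (map suc R ++ map suc (blocks (c ∘ suc) k)) ++ replicate (c 0) 0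
      ≡⟨ cong (_++ replicate (c 0) 0) (≡.sym (map-++ suc R _)) ⟩
    map suc (blocks (c ∘ suc) (suc k)) ++ replicate (c 0) 0 ∎
    where R = replicate (c (suc k)) k

  -- Shortest processing time first on one machine.

  -- Jobs of lengths 1 + t a run on one machine in the order of decreasing index a.

  startTime : ∀ {n} → (Fin n → ℕ) → Fin n → ℕ
  startTime t zero    = sum (tabulate (suc ∘ t ∘ suc))
  startTime t (suc a) = startTime (t ∘ suc) a

  endTime : ∀ {n} → (Fin n → ℕ) → Fin n → ℕ
  endTime t a = startTime t a + suc (t a)

  endTime≤sum : ∀ {n} (t : Fin n → ℕ) a → endTime t a ≤ sum (tabulate (suc ∘ t))
  endTime≤sum t zero    = ℕ.≤-reflexive (ℕ.+-comm _ (suc (t zero)))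
  endTime≤sum t (suc a) = ℕ.≤-trans (endTime≤sum (t ∘ suc) a) (ℕ.m≤n+m _ (suc (t zero)))

  endTime≤startTime : ∀ {n} (t : Fin n → ℕ) {a b} → a Fin.< b → endTime t b ≤ startTime t a
  endTime≤startTime t {zero}  {suc b} _         = endTime≤sum (t ∘ suc) b
  endTime≤startTime t {suc a} {suc b} (s≤s a<b) = endTime≤startTime (t ∘ suc) a<b

  -- Of two jobs the shorter one runs first and delays the other by 1 + min, which is the pair cost
  -- for `d = 0`. Doubling the sum makes ordered pairs of it; a job's own length is then needed
  -- twice, but the diagonal supplies it once, hence the additional sum.
  sum-endTime : ∀ {n} (t : Fin n → ℕ) → AllPairs _≥_ (tabulate t) →
                2 * sum (tabulate (endTime t)) ≡
                totalPairCost 0 (tabulate t) + sum (tabulate (suc ∘ t))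
  sum-endTime {zero}  t _         = ≡.refl
  sum-endTime {suc n} t (ge ∷ srt) = begin
    2 * (s + suc x + sum (tabulate (endTime (t ∘ suc))))
      ≡⟨ ℕ.*-distribˡ-+ 2 (s + suc x) _ ⟩
    2 * (s + suc x) + 2 * sum (tabulate (endTime (t ∘ suc)))
      ≡⟨ cong (2 * (s + suc x) +_) (sum-endTime (t ∘ suc) srt) ⟩
    2 * (s + suc x) + (totalPairCost 0 xs + s)
      ≡⟨ shuffle s x (totalPairCost 0 xs) ⟩
    suc x + s + (s + totalPairCost 0 xs) + (suc x + s)
      ≡⟨ cong₂ (λ y z → y + s + (z + totalPairCost 0 xs) + (suc x + s)) (≡.sym (pairCost-diag 0 x)) (≡.sym column) ⟩
    pairCost 0 x x + s + (sum (map (λ a → pairCost 0 a x) xs) + totalPairCost 0 xs) + (suc x + s)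
      ≡⟨ cong₂ (λ y z → pairCost 0 x x + y + z + (suc x + s)) (≡.sym row)
           (≡.sym (sum-map-+ (λ a → pairCost 0 a x) (λ a → rowCost 0 a xs) xs)) ⟩
    totalPairCost 0 (x ∷ xs) + (suc x + s) ∎
    where
      x = t zero
      xs = tabulate (t ∘ suc)
      s = sum (tabulate (suc ∘ t ∘ suc))
      map-suc≡ : ∀ {ys} → All (x ≥_) ys → map (pairCost 0 x) ys ≡ map suc ys
      map-suc≡ []       = ≡.refl
      map-suc≡ (p ∷ ps) = cong₂ _∷_ (pairCost₀-≥ p) (map-suc≡ ps)
      row : rowCost 0 x xs ≡ s
      row = cong sum (≡.trans (map-suc≡ ge) (map-tabulate (t ∘ suc) suc))
      column : sum (map (λ a → pairCost 0 a x) xs) ≡ s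
      column = ≡.trans (cong sum (map-cong (λ a → pairCost-comm 0 a x) xs)) row
      shuffle : ∀ s x p → 2 * (s + suc x) + (p + s) ≡ suc x + s + (s + p) + (suc x + s)
      shuffle = solve-∀

-- Ordered field arithmetic.

module OrderedFieldProperties {c ℓ₁ ℓ₂} (F : ArchimedeanOrderedField c ℓ₁ ℓ₂) where

  open ArchimedeanOrderedField F hiding (zero)
  open OutcomeExistence F public using (0≤1; 0≤fromℕ; +-cancelʳ-≤)
  open Algebra.Properties.Semiring.Mult semiring using (×-homo-+; ×1-homo-*)
  open Algebra.Properties.Semiring.Sum semiring public
    using (sum-cong-≋; ∑-distrib-+; ∑-comm; sum-permute; *-distribˡ-sum; sum-replicate-zero)
  open Algebra.Properties.Ring ring public using (+-cancelʳ)

  module Solver = Algebra.Solver.Ring.NaturalCoefficients.Default commutativeSemiring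

  ≤-poset : Poset c ℓ₁ ℓ₂
  ≤-poset = record { isPartialOrder = IsDecTotalOrder.isPartialOrder isDecTotalOrder }

  module ≤-Reasoning = Relation.Binary.Reasoning.PartialOrder ≤-poset
  open ≤-Reasoning

  +-mono-≤ : ∀ {x y u v} → x ≤ y → u ≤ v → x + u ≤ y + v
  +-mono-≤ {x} {y} {u} {v} x≤y u≤v = begin
    x + u ≤⟨ +-monoˡ-≤ u x≤y ⟩
    y + u ≈⟨ +-comm y u ⟩
    u + y ≤⟨ +-monoˡ-≤ y u≤v ⟩
    v + y ≈⟨ +-comm v y ⟩
    y + v ∎

  +-monoʳ-≤ : ∀ {u v} x → u ≤ v → x + u ≤ x + v
  +-monoʳ-≤ x = +-mono-≤ (≤-refl {x})

  +-nonNeg : ∀ {x y} → 0# ≤ x → 0# ≤ y → 0# ≤ x + y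
  +-nonNeg p q = ≤-respˡ-≈ (+-identityʳ 0#) (+-mono-≤ p q)

  x≤x+y : ∀ {x y} → 0# ≤ y → x ≤ x + y
  x≤x+y {x} p = ≤-respˡ-≈ (+-identityʳ x) (+-monoʳ-≤ x p)

  x≤y+x : ∀ {x y} → 0# ≤ y → x ≤ y + x
  x≤y+x {x} p = ≤-respˡ-≈ (+-identityˡ x) (+-monoˡ-≤ x p)

  x-y+y≈x : ∀ x y → x - y + y ≈ x
  x-y+y≈x x y = trans (+-assoc x (- y) y) (trans (+-congˡ (-‿inverseˡ y)) (+-identityʳ x))

  x≤y+z⇒x-z≤y : ∀ {x y z} → x ≤ y + z → x - z ≤ y
  x≤y+z⇒x-z≤y {x} {y} {z} p = +-cancelʳ-≤ z (≤-respˡ-≈ (sym (x-y+y≈x x z)) p)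

  *-monoʳ-≤ : ∀ {x y z} → 0# ≤ z → x ≤ y → z * x ≤ z * y
  *-monoʳ-≤ {x} {y} {z} 0≤z x≤y = begin
    z * x                  ≤⟨ x≤y+x (*-nonNeg 0≤z 0≤y-x) ⟩
    z * (y - x) + z * x    ≈⟨ sym (distribˡ z (y - x) x) ⟩
    z * (y - x + x)        ≈⟨ *-congˡ (x-y+y≈x y x) ⟩
    z * y                  ∎
    where
      0≤y-x : 0# ≤ y - x
      0≤y-x = +-cancelʳ-≤ x (≤-respˡ-≈ (sym (+-identityˡ x)) (≤-respʳ-≈ (sym (x-y+y≈x y x)) x≤y))

  *-monoˡ-≤ : ∀ {x y z} → 0# ≤ z → x ≤ y → x * z ≤ y * z
  *-monoˡ-≤ {x} {y} {z} 0≤z x≤y =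
    ≤-respˡ-≈ (*-comm z x) (≤-respʳ-≈ (*-comm z y) (*-monoʳ-≤ 0≤z x≤y))

  0<⇒≉0 : ∀ {x} → 0# < x → ¬ x ≈ 0#
  0<⇒≉0 (_ , 0≉x) x≈0 = 0≉x (sym x≈0)

  *-cancelˡ : ∀ {x y z} → ¬ z ≈ 0# → z * x ≈ z * y → x ≈ y
  *-cancelˡ {x} {y} {z} z≉0 eq = trans (sym (recover x)) (trans (*-congˡ eq) (recover y))
    where
      recover : ∀ w → z ⁻¹ * (z * w) ≈ w
      recover w = trans (sym (*-assoc _ z w))
        (trans (*-congʳ (trans (*-comm _ z) (⁻¹-inverseʳ z≉0))) (*-identityˡ w))

  *-cancelˡ-≤ : ∀ {x y z} → 0# < z → z * x ≤ z * y → x ≤ y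
  *-cancelˡ-≤ {x} {y} {z} 0<z zx≤zy with total x y
  ... | inj₁ x≤y = x≤y
  ... | inj₂ y≤x = ≤-reflexive
    (*-cancelˡ (0<⇒≉0 0<z) (antisym zx≤zy (*-monoʳ-≤ (proj₁ 0<z) y≤x)))

  *-cancelˡ-< : ∀ {x y z} → 0# < z → z * x < z * y → x < y
  *-cancelˡ-< 0<z (zx≤zy , zx≉zy) = *-cancelˡ-≤ 0<z zx≤zy , zx≉zy ∘ *-congˡ

  x<x+y : ∀ {x y} → 0# < y → x < x + y
  x<x+y {x} {y} (0≤y , 0≉y) = x≤x+y 0≤y , λ eq →
    0≉y (+-cancelʳ x 0# y (trans (+-identityˡ x) (trans eq (+-comm x y))))

  x<y+z⇒x-z<y : ∀ {x y z} → x < y + z → x - z < y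
  x<y+z⇒x-z<y {x} {y} {z} (p , q) = x≤y+z⇒x-z≤y p , λ eq →
    q (trans (sym (x-y+y≈x x z)) (+-congʳ eq))

  <-≤-trans : ∀ {x y z} → x < y → y ≤ z → x < z
  <-≤-trans (x≤y , x≉y) y≤z = ≤-trans x≤y y≤z , λ x≈z →
    x≉y (antisym x≤y (≤-respʳ-≈ (sym x≈z) y≤z))

  ≤-<-trans : ∀ {x y z} → x ≤ y → y < z → x < z
  ≤-<-trans x≤y (y≤z , y≉z) = ≤-trans x≤y y≤z , λ x≈z →
    y≉z (antisym y≤z (≤-respˡ-≈ x≈z x≤y))

  <-respʳ-≈ : ∀ {x y z} → y ≈ z → x < y → x < z
  <-respʳ-≈ y≈z (x≤y , x≉y) = ≤-respʳ-≈ y≈z x≤y , λ x≈z → x≉y (trans x≈z (sym y≈z))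

  +-monoʳ-< : ∀ {y z} x → y < z → x + y < x + z
  +-monoʳ-< {y} {z} x (y≤z , y≉z) = +-monoʳ-≤ x y≤z , λ eq →
    y≉z (+-cancelʳ x y z (trans (+-comm y x) (trans eq (+-comm x z))))

  0<fromℕ : ∀ n → .{{ℕ.NonZero n}} → 0# < fromℕ n
  0<fromℕ (suc n) = 0≤fromℕ (suc n) , λ eq →
    0≉1 (antisym 0≤1 (≤-respʳ-≈ (sym eq) (x≤x+y (0≤fromℕ n))))

  fromℕ-+ : ∀ m n → fromℕ (m ℕ.+ n) ≈ fromℕ m + fromℕ n
  fromℕ-+ = ×-homo-+ 1#

  fromℕ-* : ∀ m n → fromℕ (m ℕ.* n) ≈ fromℕ m * fromℕ n
  fromℕ-* = ×1-homo-*

  fromℕ-^ : ∀ m k → fromℕ m ^ k ≈ fromℕ (m ℕ.^ k)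
  fromℕ-^ m zero    = sym (+-identityʳ 1#)
  fromℕ-^ m (suc k) = trans (*-congˡ (fromℕ-^ m k)) (sym (fromℕ-* m (m ℕ.^ k)))

  fromℕ-mono : ∀ {m n} → m ℕ.≤ n → fromℕ m ≤ fromℕ n
  fromℕ-mono {m} {n} m≤n with d , eq ← ℕ.m≤n⇒∃[o]m+o≡n m≤n =
    ≤-respʳ-≈ (trans (sym (fromℕ-+ m d)) (reflexive (cong fromℕ eq))) (x≤x+y (0≤fromℕ d))

  archimedean-* : ∀ x {ε} → 0# < ε → ∃[ n ] x ≤ fromℕ n * ε
  archimedean-* x {ε} 0<ε with n , x/ε≤n ← archimedean (x ÷ ε) = n , (begin
    x               ≈⟨ sym (*-identityʳ x) ⟩
    x * 1#          ≈⟨ *-congˡ (trans (sym (⁻¹-inverseʳ (0<⇒≉0 0<ε))) (*-comm ε _)) ⟩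
    x * (ε ⁻¹ * ε)  ≈⟨ sym (*-assoc x _ ε) ⟩
    (x ÷ ε) * ε     ≤⟨ *-monoˡ-≤ (proj₁ 0<ε) x/ε≤n ⟩
    fromℕ n * ε     ∎)

  0<⁻¹ : ∀ {x} → 0# < x → 0# < x ⁻¹
  0<⁻¹ {x} 0<x = *-cancelˡ-< 0<x
    ( ≤-respˡ-≈ (sym (zeroʳ x)) (≤-respʳ-≈ (sym x*x⁻¹≈1) 0≤1)
    , λ eq → 0≉1 (trans (sym (zeroʳ x)) (trans eq x*x⁻¹≈1)))
    where x*x⁻¹≈1 = ⁻¹-inverseʳ (0<⇒≉0 0<x)

  x*y≤z⇒x≤z÷y : ∀ {x y z} → 0# < y → x * y ≤ z → x ≤ z ÷ y
  x*y≤z⇒x≤z÷y {x} {y} {z} 0<y xy≤z = begin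
    x                ≈⟨ sym (*-identityʳ x) ⟩
    x * 1#           ≈⟨ *-congˡ (sym (⁻¹-inverseʳ (0<⇒≉0 0<y))) ⟩
    x * (y * y ⁻¹)   ≈⟨ sym (*-assoc x y _) ⟩
    x * y * y ⁻¹     ≤⟨ *-monoˡ-≤ (proj₁ (0<⁻¹ 0<y)) xy≤z ⟩
    z ÷ y            ∎

  sum-mono : ∀ {n} {f g : Fin n → Carrier} → (∀ i → f i ≤ g i) → sum f ≤ sum g
  sum-mono {zero}  p = ≤-refl
  sum-mono {suc n} p = +-mono-≤ (p zero) (sum-mono (p ∘ suc))

  sum-const : ∀ n x → sum {n} (λ _ → x) ≈ fromℕ n * x
  sum-const zero    x = sym (zeroˡ x)
  sum-const (suc n) x = trans (+-cong (sym (*-identityˡ x)) (sum-const n x)) (sym (distribʳ x 1# (fromℕ n)))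

  sum-fromℕ : ∀ {n} (h : Fin n → ℕ) → sum (fromℕ ∘ h) ≈ fromℕ (ListAction.sum (tabulate h))
  sum-fromℕ {zero}  h = refl
  sum-fromℕ {suc n} h = trans (+-congˡ (sum-fromℕ (h ∘ suc))) (sym (fromℕ-+ (h zero) _))

-- The bound and its limit.

-- numer K / denom K = (2 - 4^-K) / (4 - 4^-K).
numer denom : ℕ → ℕ
numer K = ℕ.pred (2 ℕ.* 4 ℕ.^ K)
denom K = suc (2 ℕ.* numer K)

suc-numer : ∀ K → suc (numer K) ≡ 2 ℕ.* 4 ℕ.^ K
suc-numer K = ℕ.suc-pred (2 ℕ.* 4 ℕ.^ K) {{ℕ.m*n≢0 2 (4 ℕ.^ K) {{_}} {{ℕ.m^n≢0 4 K}}}}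

suc-denom : ∀ K → suc (denom K) ≡ 4 ℕ.* 4 ℕ.^ K
suc-denom K = ≡.trans (double (numer K)) (≡.trans (cong (2 ℕ.*_) (suc-numer K)) (assoc (4 ℕ.^ K)))
  where
    double : ∀ p → 2 ℕ.+ 2 ℕ.* p ≡ 2 ℕ.* suc p
    double = solve-∀
    assoc : ∀ x → 2 ℕ.* (2 ℕ.* x) ≡ 4 ℕ.* x
    assoc = solve-∀

module _ {c ℓ₁ ℓ₂} (F : ArchimedeanOrderedField c ℓ₁ ℓ₂) where

  open ArchimedeanOrderedField F hiding (zero)
  open Scheduling F using (dyadicBound; TendsTo)
  open OrderedFieldProperties F
  open ≤-Reasoning

  private
    x*[u-x⁻¹]+1≈x*u : ∀ {x} u → ¬ x ≈ 0# → x * (u - x ⁻¹) + 1# ≈ x * u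
    x*[u-x⁻¹]+1≈x*u {x} u x≉0 = begin-equality
      x * (u - x ⁻¹) + 1#        ≈⟨ +-congˡ (sym (⁻¹-inverseʳ x≉0)) ⟩
      x * (u - x ⁻¹) + x * x ⁻¹  ≈⟨ sym (distribˡ x _ _) ⟩
      x * (u - x ⁻¹ + x ⁻¹)      ≈⟨ *-congˡ (x-y+y≈x u (x ⁻¹)) ⟩
      x * u                      ∎

    -- Multiplication by 4^K turns k - 4^-K into the integer k 4^K - 1. The equation for `suc r`
    -- names that predecessor without truncated subtraction.
    clear : ∀ K k r → suc r ≡ k ℕ.* 4 ℕ.^ K →
            fromℕ 4 ^ K * (fromℕ k - (fromℕ 4 ^ K) ⁻¹) ≈ fromℕ r
    clear K k r eq = +-cancelʳ 1# _ _ (begin-equality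
      X * (fromℕ k - X ⁻¹) + 1#     ≈⟨ x*[u-x⁻¹]+1≈x*u (fromℕ k) X≉0 ⟩
      X * fromℕ k                   ≈⟨ trans (*-comm X _) (*-congˡ (fromℕ-^ 4 K)) ⟩
      fromℕ k * fromℕ (4 ℕ.^ K)     ≈⟨ sym (fromℕ-* k (4 ℕ.^ K)) ⟩
      fromℕ (k ℕ.* 4 ℕ.^ K)         ≡⟨ cong fromℕ (≡.sym eq) ⟩
      1# + fromℕ r                  ≈⟨ +-comm 1# (fromℕ r) ⟩
      fromℕ r + 1#                  ∎)
      where
        X = fromℕ 4 ^ K
        X≉0 : ¬ X ≈ 0#
        X≉0 X≈0 = 0<⇒≉0 (0<fromℕ (4 ℕ.^ K) {{ℕ.m^n≢0 4 K}}) (trans (sym (fromℕ-^ 4 K)) X≈0)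

  denom*dyadicBound : ∀ K → fromℕ (denom K) * dyadicBound K ≈ fromℕ 3 * fromℕ (numer K)
  denom*dyadicBound K = begin-equality
    R * ((fromℕ 3 * u) ÷ v)        ≈⟨ *-congʳ (sym Xv≈R) ⟩
    X * v * (fromℕ 3 * u * v ⁻¹)   ≈⟨ solve 5 (λ x v t u w → x :* v :* (t :* u :* w) := t :* (x :* u) :* (v :* w)) refl X v (fromℕ 3) u (v ⁻¹) ⟩
    fromℕ 3 * (X * u) * (v * v ⁻¹) ≈⟨ *-cong (*-congˡ (clear K 2 (numer K) (suc-numer K))) (⁻¹-inverseʳ v≉0) ⟩
    fromℕ 3 * fromℕ (numer K) * 1# ≈⟨ *-identityʳ _ ⟩
    fromℕ 3 * fromℕ (numer K)      ∎
    where
      open Solver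
      X = fromℕ 4 ^ K
      R = fromℕ (denom K)
      u = fromℕ 2 - X ⁻¹
      v = fromℕ 4 - X ⁻¹
      Xv≈R : X * v ≈ R
      Xv≈R = clear K 4 (denom K) (suc-denom K)
      v≉0 : ¬ v ≈ 0#
      v≉0 v≈0 = 0<⇒≉0 (0<fromℕ (denom K)) (trans (sym Xv≈R) (trans (*-congˡ v≈0) (zeroʳ X)))

  dyadicBound-tendsTo : TendsTo dyadicBound (fromℕ 3 ÷ fromℕ 2)
  dyadicBound-tendsTo ε 0<ε with M , 3≤Mε ← archimedean-* (fromℕ 3) 0<ε = M , λ K M≤K →
    let
      L = fromℕ 3 ÷ fromℕ 2
      b = dyadicBound K
      R = fromℕ (denom K)
      P = fromℕ (numer K)
      2R = fromℕ 2 * R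

      0<2R : 0# < 2R
      0<2R = <-respʳ-≈ (fromℕ-* 2 (denom K)) (0<fromℕ (2 ℕ.* denom K))

      R≈ : R ≈ 1# + fromℕ 2 * P
      R≈ = +-congˡ (fromℕ-* 2 (numer K))

      -- Since `denom K` is 1 + 2 `numer K`, the distance from 3/2 is exactly 3 / (2 `denom K`).
      gap : 2R * L ≈ 2R * b + fromℕ 3
      gap = begin-equality
        fromℕ 2 * R * (fromℕ 3 * fromℕ 2 ⁻¹)
          ≈⟨ solve 4 (λ t r s w → t :* r :* (s :* w) := r :* s :* (t :* w)) refl (fromℕ 2) R (fromℕ 3) (fromℕ 2 ⁻¹) ⟩
        R * fromℕ 3 * (fromℕ 2 * fromℕ 2 ⁻¹)
          ≈⟨ *-cong (*-congʳ R≈) (⁻¹-inverseʳ (0<⇒≉0 (0<fromℕ 2))) ⟩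
        (1# + fromℕ 2 * P) * fromℕ 3 * 1#
          ≈⟨ solve 3 (λ t p s → (con 1 :+ t :* p) :* s :* con 1 := t :* (s :* p) :+ s) refl (fromℕ 2) P (fromℕ 3) ⟩
        fromℕ 2 * (fromℕ 3 * P) + fromℕ 3
          ≈⟨ +-congʳ (*-congˡ (sym (denom*dyadicBound K))) ⟩
        fromℕ 2 * (R * b) + fromℕ 3
          ≈⟨ +-congʳ (sym (*-assoc _ R b)) ⟩
        2R * b + fromℕ 3 ∎

      b≤L : b ≤ L
      b≤L = *-cancelˡ-≤ 0<2R (≤-respʳ-≈ (sym gap) (x≤x+y (0≤fromℕ 3)))

      -- `M` satisfies 3 ≤ M ε, and M ≤ K < 2 `denom K` leaves room for one further ε, which makes
      -- the inequality strict.
      3<2Rε : fromℕ 3 < 2R * ε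
      3<2Rε = begin-strict
        fromℕ 3             ≤⟨ 3≤Mε ⟩
        fromℕ M * ε         <⟨ x<x+y 0<ε ⟩
        fromℕ M * ε + ε     ≈⟨ solve 2 (λ m e → m :* e :+ e := (con 1 :+ m) :* e) refl (fromℕ M) ε ⟩
        fromℕ (suc M) * ε   ≤⟨ *-monoˡ-≤ (proj₁ 0<ε) (fromℕ-mono (ℕ.≤-trans (ℕ.s≤s M≤K) (K<2denom K))) ⟩
        fromℕ (2 ℕ.* denom K) * ε ≈⟨ *-congʳ (fromℕ-* 2 (denom K)) ⟩
        2R * ε ∎

      L<b+ε : L < b + ε
      L<b+ε = *-cancelˡ-< 0<2R (begin-strict
        2R * L            ≈⟨ gap ⟩
        2R * b + fromℕ 3  <⟨ +-monoʳ-< (2R * b) 3<2Rε ⟩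
        2R * b + 2R * ε   ≈⟨ sym (distribˡ 2R b ε) ⟩
        2R * (b + ε)      ∎)
    in x<y+z⇒x-z<y L<b+ε , ≤-<-trans b≤L (x<x+y 0<ε)
    where
      open Solver

      K<4^K : ∀ K → K ℕ.< 4 ℕ.^ K
      K<4^K zero    = ℕ.s≤s ℕ.z≤n
      K<4^K (suc K) = ℕ.≤-trans (ℕ.+-mono-≤ (ℕ.m^n>0 4 K) (K<4^K K))
        (ℕ.+-monoʳ-≤ (4 ℕ.^ K) (ℕ.m≤m+n (4 ℕ.^ K) _))

      K<2denom : ∀ K → K ℕ.< 2 ℕ.* denom K
      K<2denom K = ℕ.≤-trans (K<4^K K) (ℕ.≤-trans (ℕ.m≤n*m (4 ℕ.^ K) 4)
        (ℕ.≤-trans (ℕ.≤-reflexive (≡.sym (suc-denom K)))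
          (ℕ.≤-trans (ℕ.m≤m+n _ (2 ℕ.* numer K ℕ.+ 0)) (ℕ.≤-reflexive (twice (2 ℕ.* numer K))))))
        where
          twice : ∀ d → suc (suc d) ℕ.+ (d ℕ.+ 0) ≡ 2 ℕ.* suc d
          twice = solve-∀

-- Comparing the quadratic terms.

module _ {c ℓ₁ ℓ₂} (F : ArchimedeanOrderedField c ℓ₁ ℓ₂) where

  open ArchimedeanOrderedField F hiding (zero)
  open OrderedFieldProperties F
  open ≤-Reasoning

  -- Here n = q E is the number of jobs per machine: the leading terms in q² balance exactly and
  -- the slack ε absorbs the linear term of the upper bound on o.
  absorb-linear-term : ∀ {P R m q E b ε a o} →
    0# ≤ P → 1# ≤ R → 0# ≤ m → 0# ≤ q → 0# ≤ E → 0# ≤ ε → 0# ≤ b - ε →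
    R * b ≈ fromℕ 3 * P →
    fromℕ 18 * (P * E) ≤ q * ε →
    P * (q * q) * m ≤ fromℕ 2 * a →
    fromℕ 6 * o ≤ m * (R * (q * q) + fromℕ 6 * (q * E)) →
    (b - ε) * o ≤ a
  absorb-linear-term {P} {R} {m} {q} {E} {b} {ε} {a} {o} 0≤P 1≤R 0≤m 0≤q 0≤E 0≤ε 0≤c Rb≈3P large lower upper =
    *-cancelˡ-≤ {z = fromℕ 6 * R} 0<6R (begin
      fromℕ 6 * R * (c₀ * o)
        ≈⟨ solve 4 (λ s r c o → s :* r :* (c :* o) := r :* c :* (s :* o)) refl (fromℕ 6) R c₀ o ⟩
      R * c₀ * (fromℕ 6 * o)
        ≤⟨ *-monoʳ-≤ (*-nonNeg 0≤R 0≤c) upper ⟩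
      R * c₀ * (m * (R * (q * q) + fromℕ 6 * (q * E)))
        ≈⟨ solve 6 (λ r c m q s e → r :* c :* (m :* (r :* (q :* q) :+ s :* (q :* e))) :=
             m :* q :* (r :* c :* (r :* q) :+ r :* c :* (s :* e))) refl R c₀ m q (fromℕ 6) E ⟩
      m * q * (R * c₀ * (R * q) + R * c₀ * (fromℕ 6 * E))
        ≤⟨ *-monoʳ-≤ (*-nonNeg 0≤m 0≤q) (+-monoʳ-≤ _ error) ⟩
      m * q * (R * c₀ * (R * q) + R * ε * (R * q))
        ≈⟨ *-congˡ (trans (sym (distribʳ (R * q) (R * c₀) (R * ε))) (*-congʳ Rc+Rε≈3P)) ⟩
      m * q * (fromℕ 3 * P * (R * q))
        ≈⟨ solve 5 (λ m q t p r → m :* q :* (t :* p :* (r :* q)) := t :* r :* (p :* (q :* q) :* m)) refl m q (fromℕ 3) P R ⟩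
      fromℕ 3 * R * (P * (q * q) * m)
        ≤⟨ *-monoʳ-≤ (*-nonNeg (0≤fromℕ 3) 0≤R) lower ⟩
      fromℕ 3 * R * (fromℕ 2 * a)
        ≈⟨ solve 4 (λ t r d a → t :* r :* (d :* a) := t :* d :* r :* a) refl (fromℕ 3) R (fromℕ 2) a ⟩
      fromℕ 3 * fromℕ 2 * R * a
        ≈⟨ *-congʳ (*-congʳ (sym (fromℕ-* 3 2))) ⟩
      fromℕ 6 * R * a ∎)
    where
      open Solver
      c₀ = b - ε

      0<R : 0# < R
      0<R = ≤-trans 0≤1 1≤R , λ 0≈R → 0≉1 (antisym 0≤1 (≤-respʳ-≈ (sym 0≈R) 1≤R))

      0≤R = proj₁ 0<R

      0<6R : 0# < fromℕ 6 * R
      0<6R = *-nonNeg (0≤fromℕ 6) 0≤R , λ eq →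
        0<⇒≉0 0<R (*-cancelˡ (0<⇒≉0 (0<fromℕ 6)) (trans (sym eq) (sym (zeroʳ _))))

      Rc+Rε≈3P : R * c₀ + R * ε ≈ fromℕ 3 * P
      Rc+Rε≈3P = trans (sym (distribˡ R c₀ ε)) (trans (*-congˡ (x-y+y≈x b ε)) Rb≈3P)

      x≤R*x : ∀ {x} → 0# ≤ x → x ≤ R * x
      x≤R*x {x} 0≤x = ≤-respˡ-≈ (*-identityˡ x) (*-monoˡ-≤ 0≤x 1≤R)

      -- As R (b - ε) ≤ R b = 3 P, the error is at most 3 · 6 P E, the origin of the 18 in the
      -- hypothesis. Using `1# ≤ R` twice then pads q ε to the required shape.
      error : R * c₀ * (fromℕ 6 * E) ≤ R * ε * (R * q)
      error = begin
        R * c₀ * (fromℕ 6 * E)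
          ≤⟨ *-monoˡ-≤ (*-nonNeg (0≤fromℕ 6) 0≤E) (≤-respʳ-≈ Rc+Rε≈3P (x≤x+y (*-nonNeg 0≤R 0≤ε))) ⟩
        fromℕ 3 * P * (fromℕ 6 * E)
          ≈⟨ solve 4 (λ t p s e → t :* p :* (s :* e) := t :* s :* (p :* e)) refl (fromℕ 3) P (fromℕ 6) E ⟩
        fromℕ 3 * fromℕ 6 * (P * E)
          ≈⟨ *-congʳ (sym (fromℕ-* 3 6)) ⟩
        fromℕ 18 * (P * E)
          ≤⟨ large ⟩
        q * ε
          ≤⟨ ≤-trans (x≤R*x (*-nonNeg 0≤q 0≤ε)) (x≤R*x (*-nonNeg 0≤R (*-nonNeg 0≤q 0≤ε))) ⟩
        R * (R * (q * ε))
          ≈⟨ solve 3 (λ r q e → r :* (r :* (q :* e)) := r :* e :* (r :* q)) refl R q ε ⟩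
        R * ε * (R * q) ∎

-- Machine load and work on pairs of jobs.

module _ {c ℓ₁ ℓ₂} (F : ArchimedeanOrderedField c ℓ₁ ℓ₂) where

  open ArchimedeanOrderedField F hiding (zero)
  open OrderedFieldProperties F
  open Scheduling F
  open ≤-Reasoning hiding (start)

  gate : Bool → Carrier → Carrier
  gate b x = if b then x else 0#

  gate-nonNeg : ∀ b {x} → 0# ≤ x → 0# ≤ gate b x
  gate-nonNeg true  0≤x = 0≤x
  gate-nonNeg false 0≤x = ≤-refl

  sum-gate : ∀ {m} (k : Fin m) x → sum (λ i → gate (does (k ≟ᶠ i)) x) ≈ x
  sum-gate {suc m} zero    x = trans (+-congˡ (sum-replicate-zero m)) (+-identityʳ x)
  sum-gate         (suc k) x = trans (+-identityˡ _) (sum-gate k x)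

  module _ {a} {A : Set a} (f : A → Carrier) where

    listSum : List A → Carrier
    listSum []       = 0#
    listSum (x ∷ xs) = f x + listSum xs

    listSum-++ : ∀ xs ys → listSum (xs ++ ys) ≈ listSum xs + listSum ys
    listSum-++ []       ys = sym (+-identityˡ _)
    listSum-++ (x ∷ xs) ys = trans (+-congˡ (listSum-++ xs ys)) (sym (+-assoc _ _ _))

    listSum-tabulate : ∀ {n} (g : Fin n → A) → listSum (tabulate g) ≈ sum (f ∘ g)
    listSum-tabulate {zero}  g = refl
    listSum-tabulate {suc n} g = +-congˡ (listSum-tabulate (g ∘ suc))

    listSum-filter-∷ : ∀ {p} {P : A → Set p} (P? : Decidable P) x xs →
      listSum (filter P? (x ∷ xs)) ≈ gate (does (P? x)) (f x) + listSum (filter P? xs)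
    listSum-filter-∷ P? x xs with does (P? x)
    ... | true  = refl
    ... | false = sym (+-identityˡ _)

    listSum-partition : ∀ {p} {P : A → Set p} (P? : Decidable P) xs →
      listSum xs ≈ listSum (filter P? xs) + listSum (filter (¬? ∘ P?) xs)
    listSum-partition P? []       = sym (+-identityˡ 0#)
    listSum-partition P? (x ∷ xs) with does (P? x)
    ... | true  = trans (+-congˡ (listSum-partition P? xs)) (sym (+-assoc _ _ _))
    ... | false = trans (+-congˡ (listSum-partition P? xs))
      (solve 3 (λ x y z → x :+ (y :+ z) := y :+ (x :+ z)) refl _ _ _)
      where open Solver

    listSum-classes : ∀ {m} (k : A → Fin m) xs →
      sum (λ i → listSum (filter (λ x → k x ≟ᶠ i) xs)) ≈ listSum xs
    listSum-classes {m} k []       = sum-replicate-zero m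
    listSum-classes     k (x ∷ xs) = begin-equality
      sum (λ i → listSum (filter (λ x → k x ≟ᶠ i) (x ∷ xs)))
        ≈⟨ sum-cong-≋ (λ i → listSum-filter-∷ (λ x → k x ≟ᶠ i) x xs) ⟩
      sum (λ i → gate (does (k x ≟ᶠ i)) (f x) + listSum (filter (λ x → k x ≟ᶠ i) xs))
        ≈⟨ ∑-distrib-+ (λ i → gate (does (k x ≟ᶠ i)) (f x)) _ ⟩
      sum (λ i → gate (does (k x ≟ᶠ i)) (f x)) + sum (λ i → listSum (filter (λ x → k x ≟ᶠ i) xs))
        ≈⟨ +-cong (sum-gate (k x) (f x)) (listSum-classes k xs) ⟩
      f x + listSum xs ∎

  listSum-filter : ∀ {a p} {A : Set a} {P : A → Set p} (f : A → Carrier) (P? : Decidable P) xs →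
    listSum f (filter P? xs) ≈ listSum (λ x → gate (does (P? x)) (f x)) xs
  listSum-filter f P? []       = refl
  listSum-filter f P? (x ∷ xs) = trans (listSum-filter-∷ f P? x xs) (+-congˡ (listSum-filter f P? xs))

  module Load {m N} {I : Instance N} {S : Schedule m N} (feas : Feasible I S) where

    open Feasible feas

    C : Op N → Time
    C = completion I S

    duration≥0 : ∀ o → 0# ≤ duration I o
    duration≥0 (τ j) = testTime≥0 I j
    duration≥0 (π j) = procTime≥0 I j

    C≥0 : ∀ o → 0# ≤ C o
    C≥0 o = +-nonNeg (start≥0 o) (duration≥0 o)

    -- Quicksort around a pivot operation: unlike removing the last operation,
    -- this needs no special treatment of operations of length 0.
    packing : ∀ {i s e} k os → length os ℕ.≤ k → Unique os →
              All (λ o → machine S o ≡ i) os →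
              All (λ o → s ≤ start S o) os → All (λ o → C o ≤ e) os →
              s ≤ e → s + listSum (duration I) os ≤ e
    packing k [] _ _ _ _ _ s≤e = ≤-respˡ-≈ (sym (+-identityʳ _)) s≤e
    packing {i} {s} {e} (suc k) (o ∷ os) (ℕ.s≤s len) (o∉ ∷ u) (≡.refl ∷ on) (s≤ ∷ ss) (≤e ∷ es) _ = begin
      s + (d + listSum (duration I) os)
        ≈⟨ +-congˡ (+-congˡ (listSum-partition (duration I) before? os)) ⟩
      s + (d + (listSum (duration I) before + listSum (duration I) after))
        ≈⟨ solve 4 (λ s d x y → s :+ (d :+ (x :+ y)) := (s :+ x) :+ d :+ y) refl s d _ _ ⟩
      s + listSum (duration I) before + d + listSum (duration I) after
        ≤⟨ +-monoˡ-≤ _ (+-monoˡ-≤ d (packing k before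
             (ℕ.≤-trans (length-filter before? os) len) (AllPairs.filter⁺ before? u)
             (All.filter⁺ before? on) (All.filter⁺ before? ss) (All.all-filter before? os) s≤)) ⟩
      start S o + d + listSum (duration I) after
        ≤⟨ packing k after (ℕ.≤-trans (length-filter after? os) len) (AllPairs.filter⁺ after? u)
             (All.filter⁺ after? on)
             (All.zipWith (λ (x , y) → later x y) (All.all-filter after? os , All.filter⁺ after? (All.zip (o∉ , on))))
             (All.filter⁺ after? es) ≤e ⟩
      e ∎
      where
        open Solver
        d = duration I o
        before? = λ o′ → C o′ ≤? start S o
        after? = ¬? ∘ before?
        before = filter before? os
        after = filter after? os
        later : ∀ {o′} → ¬ C o′ ≤ start S o → o ≢ o′ × machine S o′ ≡ machine S o → C o ≤ start S o′
        later ¬before (o≢o′ , same) with noOverlap o≢o′ (≡.sym same)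
        ... | inj₁ p = p
        ... | inj₂ p = contradiction p ¬before

    -- An operation still running at time T counts as nothing. The pair estimates only refer to
    -- completed operations, and no operation has to be cut at T.
    finished : Time → Op N → Time
    finished T o = gate (does (C o ≤? T)) (duration I o)

    finished-≤ : ∀ {T o} → C o ≤ T → duration I o ≈ finished T o
    finished-≤ {T} {o} p rewrite dec-true (C o ≤? T) p = refl

    finished≥0 : ∀ T o → 0# ≤ finished T o
    finished≥0 T o = gate-nonNeg (does (C o ≤? T)) (duration≥0 o)

    work : Time → Fin N → Time
    work T j = finished T (τ j) + finished T (π j)

    -- On each machine the completed operations are disjoint inside [0, T]. Regrouping the
    -- operations by machine instead of by job makes it irrelevant where the two operations of one
    -- job run.
    work≤m*T : ∀ {T} → 0# ≤ T → sum (work T) ≤ fromℕ m * T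
    work≤m*T {T} 0≤T = begin
      sum (work T)
        ≈⟨ ∑-distrib-+ (finished T ∘ τ) (finished T ∘ π) ⟩
      sum (finished T ∘ τ) + sum (finished T ∘ π)
        ≈⟨ sym (+-cong (listSum-tabulate (finished T) τ) (listSum-tabulate (finished T) π)) ⟩
      listSum (finished T) (tabulate τ) + listSum (finished T) (tabulate π)
        ≈⟨ sym (listSum-++ (finished T) (tabulate τ) (tabulate π)) ⟩
      listSum (finished T) ops
        ≈⟨ sym (listSum-filter (duration I) done? ops) ⟩
      listSum (duration I) done
        ≈⟨ sym (listSum-classes (duration I) (machine S) done) ⟩
      sum (λ i → listSum (duration I) (filter (on? i) done))
        ≤⟨ sum-mono (λ i → ≤-respˡ-≈ (+-identityˡ _) (packing _ _ ℕ.≤-refl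
             (AllPairs.filter⁺ (on? i) (AllPairs.filter⁺ done? unique))
             (All.all-filter (on? i) done) (All.universal start≥0 _)
             (All.filter⁺ (on? i) (All.all-filter done? ops)) 0≤T)) ⟩
      sum {m} (λ _ → T)
        ≈⟨ sum-const m T ⟩
      fromℕ m * T ∎
      where
        done? = λ o → C o ≤? T
        on? = λ i o → machine S o ≟ᶠ i
        ops = tabulate τ ++ tabulate π
        done = filter done? ops
        unique : Unique ops
        unique = AllPairs.++⁺
          (Unique.tabulate⁺ {f = τ} λ { ≡.refl → ≡.refl })
          (Unique.tabulate⁺ {f = π} λ { ≡.refl → ≡.refl })
          (All.tabulate⁺ {f = τ} λ _ → All.tabulate⁺ {f = π} λ _ ())

    τ≤π : ∀ j → C (τ j) ≤ C (π j)
    τ≤π j = ≤-trans (testFirst j) (x≤x+y (procTime≥0 I j))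

    module _ (unit : ∀ j → testTime I j ≈ 1#) where

      tested : ∀ {T j} → C (τ j) ≤ T → 1# ≤ work T j
      tested {T} {j} p = begin
        1#                 ≈⟨ sym (unit j) ⟩
        testTime I j       ≈⟨ finished-≤ p ⟩
        finished T (τ j)   ≤⟨ x≤x+y (finished≥0 T (π j)) ⟩
        work T j           ∎

      processed : ∀ {T j} → C (π j) ≤ T → 1# + procTime I j ≤ work T j
      processed {T} {j} p = ≤-reflexive
        (+-cong (trans (sym (unit j)) (finished-≤ (≤-trans (τ≤π j) p))) (finished-≤ p))

      work≥0 : ∀ T j → 0# ≤ work T j
      work≥0 T j = +-nonNeg (finished≥0 T (τ j)) (finished≥0 T (π j))

      -- For distinct jobs either summand alone may vanish, as one job can finish before the other
      -- is touched; only the two together admit a lower bound independent of the algorithm.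
      pairWork : Fin N → Fin N → Time
      pairWork j k = work (C (π j)) k + work (C (π k)) j

      -- Whichever job finishes first has both its operations behind it when the other finishes. The
      -- diagonal j = k is included.
      pairCost≤pairWork-≡ : ∀ {j k} a → procTime I j ≈ fromℕ a → procTime I k ≈ fromℕ a →
                            fromℕ (suc a) ≤ pairWork j k
      pairCost≤pairWork-≡ {j} {k} a pj pk with total (C (π j)) (C (π k))
      ... | inj₁ j≤k = ≤-trans (≤-respˡ-≈ (+-congˡ pj) (processed j≤k)) (x≤y+x (work≥0 _ k))
      ... | inj₂ k≤j = ≤-trans (≤-respˡ-≈ (+-congˡ pk) (processed k≤j)) (x≤x+y (work≥0 _ j))

      -- The test of the longer job j precedes that of k, so it always delays k.
      -- Either π j delays k as well, or both operations of k delay j.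
      pairCost≤pairWork-> : ∀ {j k a b} → procTime I j ≈ fromℕ a → procTime I k ≈ fromℕ b →
                            b ℕ.< a → C (τ j) ≤ C (τ k) → fromℕ (2 ℕ.+ b) ≤ pairWork j k
      pairCost≤pairWork-> {j} {k} {a} {b} pj pk b<a τj≤τk with total (C (π j)) (C (π k))
      ... | inj₁ j≤k = begin
        1# + fromℕ (suc b)    ≤⟨ +-monoʳ-≤ 1# (fromℕ-mono b<a) ⟩
        1# + fromℕ a          ≈⟨ +-congˡ (sym pj) ⟩
        1# + procTime I j     ≤⟨ processed j≤k ⟩
        work (C (π k)) j      ≤⟨ x≤y+x (work≥0 _ k) ⟩
        pairWork j k          ∎
      ... | inj₂ k≤j = begin
        1# + (1# + fromℕ b)   ≈⟨ +-comm 1# _ ⟩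
        1# + fromℕ b + 1#     ≈⟨ +-congʳ (+-congˡ (sym pk)) ⟩
        1# + procTime I k + 1# ≤⟨ +-mono-≤ (processed k≤j) (tested (≤-trans τj≤τk (τ≤π k))) ⟩
        pairWork j k          ∎

      pairWork-comm : ∀ j k → pairWork j k ≈ pairWork k j
      pairWork-comm j k = +-comm _ _

      -- Stating the test order as implications lets one lemma cover every ordered pair: only the
      -- implication for the strictly longer job, if there is one, is ever invoked.
      pairCost≤pairWork : ∀ {j k a b} → procTime I j ≈ fromℕ a → procTime I k ≈ fromℕ b →
        (b ℕ.< a → C (τ j) ≤ C (τ k)) → (a ℕ.< b → C (τ k) ≤ C (τ j)) →
        fromℕ (pairCost 1 a b) ≤ pairWork j k
      pairCost≤pairWork {j} {k} {a} {b} pj pk j-first k-first with ℕ.<-cmp a b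
      ... | tri< a<b _ _ rewrite pairCost-comm 1 a b | pairCost-> 1 a<b =
        ≤-respʳ-≈ (pairWork-comm k j) (pairCost≤pairWork-> pk pj a<b (k-first a<b))
      ... | tri≈ _ ≡.refl _ rewrite pairCost-diag 1 a = pairCost≤pairWork-≡ a pj pk
      ... | tri> _ _ b<a rewrite pairCost-> 1 b<a = pairCost≤pairWork-> pj pk b<a (j-first b<a)

      -- Exchanging the two summations identifies the two halves of `pairWork`, and each half is the
      -- load bound summed over the completion times of all jobs.
      sum-pairWork : sum (λ j → sum (pairWork j)) ≤ fromℕ 2 * (fromℕ m * totalCompletionTime I S)
      sum-pairWork = begin
        sum (λ j → sum (pairWork j))
          ≈⟨ sum-cong-≋ (λ j → ∑-distrib-+ (work (C (π j))) (λ k → work (C (π k)) j)) ⟩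
        sum (λ j → sum (work (C (π j))) + sum (λ k → work (C (π k)) j))
          ≈⟨ ∑-distrib-+ (λ j → sum (work (C (π j)))) _ ⟩
        W + sum (λ j → sum (λ k → work (C (π k)) j))
          ≈⟨ +-congˡ (∑-comm (λ j k → work (C (π k)) j)) ⟩
        W + W
          ≤⟨ +-mono-≤ W≤ W≤ ⟩
        V + V
          ≈⟨ sym (trans (distribʳ V 1# (1# + 0#)) (+-cong (*-identityˡ V) (trans (*-congʳ (+-identityʳ 1#)) (*-identityˡ V)))) ⟩
        fromℕ 2 * V ∎
        where
          W = sum (λ j → sum (work (C (π j))))
          V = fromℕ m * totalCompletionTime I S
          W≤ : W ≤ V
          W≤ = ≤-trans (sum-mono (λ j → work≤m*T (C≥0 (π j))))
            (≤-reflexive (sym (*-distribˡ-sum (fromℕ m) (C ∘ π))))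

-- From the order of the tests to a permutation.

Unique-tabulate⁻ : ∀ {a} {A : Set a} {n} {f : Fin n → A} → Unique (tabulate f) → ∀ {i j} → f i ≡ f j → i ≡ j
Unique-tabulate⁻ u {i} {j} eq with <ᶠ-cmp i j
... | tri< i<j _ _ = contradiction eq (AllPairs-tabulate⁻ u i<j)
... | tri≈ _ i≡j _ = i≡j
... | tri> _ _ j<i = contradiction (≡.sym eq) (AllPairs-tabulate⁻ u j<i)

-- This turns the adversary's order into a bijection along which sums over jobs become sums over
-- positions. Membership yields preimages and the absence of repetitions yields injectivity.
↭-allFin⇒permutation : ∀ {n} {xs : List (Fin n)} → xs ↭ allFin n →
                       ∃ λ (σ : Permutation′ n) → xs ≡ tabulate (σ ⟨$⟩ʳ_)
↭-allFin⇒permutation {n} {xs} xs↭ with ≡-tabulate xs (≡.trans (↭-length xs↭) (length-tabulate {n = n} (λ i → i)))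
... | f , ≡.refl = permutation f (proj₁ ∘ preimage) f∘pre (λ i → injective (f∘pre (f i))) , ≡.refl
  where
    preimage : ∀ j → ∃ λ i → j ≡ f i
    preimage j = ∈-tabulate⁻ (∈-resp-↭ (↭-sym xs↭) (∈-allFin j))
    f∘pre : ∀ j → f (proj₁ (preimage j)) ≡ j
    f∘pre j = ≡.sym (proj₂ (preimage j))
    injective : ∀ {i j} → f i ≡ f j → i ≡ j
    injective = Unique-tabulate⁻ (PermSetoid.Unique-resp-↭ (≡.setoid _) (↭⇒↭ₛ (↭-sym xs↭)) (Unique.allFin⁺ n))

-- Closed forms of the two pair sums.

totalPairCost₁-ladder : ∀ K Q → totalPairCost 1 (ladder K Q) ≡ numer K ℕ.* (Q ℕ.* Q)
totalPairCost₁-ladder K Q = ℕ.*-cancelˡ-≡ _ _ 3 (ℕ.+-cancelʳ-≡ (3 ℕ.* (Q ℕ.* Q)) _ _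
  (≡.trans (totalPairCost-ladder 1 K Q) (≡.trans (assoc (4 ℕ.^ K) (Q ℕ.* Q))
    (≡.trans (cong (λ x → 3 ℕ.* (x ℕ.* (Q ℕ.* Q))) (≡.sym (suc-numer K))) (expand (numer K) (Q ℕ.* Q))))))
  where
    assoc : ∀ x s → 6 ℕ.* (x ℕ.* s) ≡ 3 ℕ.* (2 ℕ.* x ℕ.* s)
    assoc = solve-∀
    expand : ∀ p s → 3 ℕ.* (suc p ℕ.* s) ≡ 3 ℕ.* (p ℕ.* s) ℕ.+ 3 ℕ.* s
    expand = solve-∀

-- The 3 kept here is the 3 in the numerator of `dyadicBound`: the quotient of the two pair sums is
-- `numer K` divided by a third of `denom K`.
3*totalPairCost₀-ladder : ∀ K Q → 3 ℕ.* totalPairCost 0 (ladder K Q) ≡ denom K ℕ.* (Q ℕ.* Q)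
3*totalPairCost₀-ladder K Q = ℕ.+-cancelʳ-≡ (1 ℕ.* (Q ℕ.* Q)) _ _
  (≡.trans (totalPairCost-ladder 0 K Q) (≡.trans (≡.sym (ℕ.*-assoc 4 (4 ℕ.^ K) (Q ℕ.* Q)))
    (≡.trans (cong (ℕ._* (Q ℕ.* Q)) (≡.sym (suc-denom K))) (expand (denom K) (Q ℕ.* Q)))))
  where
    expand : ∀ p s → suc p ℕ.* s ≡ p ℕ.* s ℕ.+ 1 ℕ.* s
    expand = solve-∀

-- The factor 6 clears the 2 from counting ordered pairs and the 3 from the geometric series.
6*sum-endTime : ∀ K q {n} (t : Fin n → ℕ) → ladder K q ≡ tabulate t →
  6 ℕ.* ListAction.sum (tabulate (endTime t)) ℕ.≤ denom K ℕ.* (q ℕ.* q) ℕ.+ 6 ℕ.* (q ℕ.* 2 ℕ.^ K)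
6*sum-endTime K q t eq = begin
  6 ℕ.* s                  ≡⟨ ℕ.*-assoc 3 2 s ⟩
  3 ℕ.* (2 ℕ.* s)          ≡⟨ cong (3 ℕ.*_) (sum-endTime t (subst (AllPairs ℕ._≥_) eq (sorted-ladder K q))) ⟩
  3 ℕ.* (totalPairCost 0 (tabulate t) ℕ.+ ListAction.sum (tabulate (suc ∘ t)))
    ≡⟨ cong₂ (λ x y → 3 ℕ.* (totalPairCost 0 x ℕ.+ ListAction.sum y)) (≡.sym eq)
         (≡.trans (≡.sym (map-tabulate t suc)) (cong (map suc) (≡.sym eq))) ⟩
  3 ℕ.* (totalPairCost 0 L ℕ.+ ListAction.sum (map suc L))
    ≤⟨ ℕ.*-monoʳ-≤ 3 (ℕ.+-monoʳ-≤ (totalPairCost 0 L) (sum-suc-ladder K q)) ⟩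
  3 ℕ.* (totalPairCost 0 L ℕ.+ 2 ℕ.* (q ℕ.* 2 ℕ.^ K))
    ≡⟨ ℕ.*-distribˡ-+ 3 (totalPairCost 0 L) _ ⟩
  3 ℕ.* totalPairCost 0 L ℕ.+ 3 ℕ.* (2 ℕ.* (q ℕ.* 2 ℕ.^ K))
    ≡⟨ cong₂ ℕ._+_ (3*totalPairCost₀-ladder K q) (≡.sym (ℕ.*-assoc 3 2 (q ℕ.* 2 ℕ.^ K))) ⟩
  denom K ℕ.* (q ℕ.* q) ℕ.+ 6 ℕ.* (q ℕ.* 2 ℕ.^ K) ∎
  where
    open ℕ.≤-Reasoning
    L = ladder K q
    s = ListAction.sum (tabulate (endTime t))

totalPairCost-tabulate : ∀ d {n} (T : Fin n → ℕ) → totalPairCost d (tabulate T) ≡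
  ListAction.sum (tabulate λ i → ListAction.sum (tabulate λ j → pairCost d (T i) (T j)))
totalPairCost-tabulate d T = cong ListAction.sum (≡.trans (map-tabulate T _)
  (tabulate-cong λ i → cong ListAction.sum (map-tabulate T (pairCost d (T i)))))

-- Outcomes of the game: both bounds and the ratio.

module _ {c ℓ₁ ℓ₂} (F : ArchimedeanOrderedField c ℓ₁ ℓ₂) where

  open ArchimedeanOrderedField F hiding (zero)
  open OrderedFieldProperties F
  open Scheduling F
  open ≤-Reasoning hiding (start)

  -- The exponent is a minimum of two numbers that both grow by one, so the divisor doubles along
  -- with the number of jobs.
  typeCount-suc : ∀ K N i → typeCount (suc K) (2 ℕ.* N) (suc i) ≡ typeCount K N i
  typeCount-suc K N i = m*n/m*o≡n/o 2 N (2 ℕ.^ (suc i ℕ.⊓ K))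
    {{ℕ.m^n≢0 2 (suc i ℕ.⊓ K)}} {{ℕ.m^n≢0 2 (suc (suc i ℕ.⊓ K))}}

  dyadicTypes≡ladder : ∀ K Q → dyadicTypes K (Q ℕ.* 2 ℕ.^ K) ≡ ladder K Q
  dyadicTypes≡ladder zero Q = ≡.trans (blocks-suc (typeCount 0 (Q ℕ.* 1)) 0)
    (cong (λ k → replicate k 0) (m*n/n≡m Q 1))
  dyadicTypes≡ladder (suc K) Q = ≡.trans
    (cong (dyadicTypes (suc K)) (double Q (2 ℕ.^ K)))
    (≡.trans (blocks-suc (typeCount (suc K) (2 ℕ.* N)) (suc K))
      (cong₂ (λ xs k → map suc xs ++ replicate k 0)
        (≡.trans (concatMap-cong (λ i → cong (λ k → replicate k i) (typeCount-suc K N i)) (downFrom (suc K)))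
                 (dyadicTypes≡ladder K Q))
        (≡.trans (cong (ℕ._/ 2) (ℕ.*-comm 2 N)) (m*n/n≡m N 2))))
    where
      N = Q ℕ.* 2 ℕ.^ K
      double : ∀ q e → q ℕ.* (2 ℕ.* e) ≡ 2 ℕ.* (q ℕ.* e)
      double = solve-∀

  module _ {m N} {I : Instance N} {S : Schedule m N} (feas : Feasible I S)
           (unit : ∀ j → testTime I j ≈ 1#) where

    open Load F feas

    1≤C : ∀ j → 1# ≤ C (π j)
    1≤C j = begin
      1#                            ≈⟨ sym (unit j) ⟩
      testTime I j                  ≤⟨ x≤y+x (Feasible.start≥0 feas (τ j)) ⟩
      C (τ j)                       ≤⟨ τ≤π j ⟩
      C (π j)                       ∎

    0<totalCompletionTime : .{{ℕ.NonZero N}} → 0# < totalCompletionTime I S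
    0<totalCompletionTime = <-≤-trans (0<fromℕ N) (begin
      fromℕ N                       ≈⟨ sym (*-identityʳ _) ⟩
      fromℕ N * 1#                  ≈⟨ sym (sum-const N 1#) ⟩
      sum {N} (λ _ → 1#)            ≤⟨ sum-mono 1≤C ⟩
      totalCompletionTime I S       ∎)

    totalPairCost≤ : ∀ (σ : Permutation′ N) (T : Fin N → ℕ) → AllPairs ℕ._≥_ (tabulate T) →
      (∀ {i j} → i Fin.< j → C (τ (σ ⟨$⟩ʳ i)) ≤ C (τ (σ ⟨$⟩ʳ j))) →
      (∀ i → procTime I (σ ⟨$⟩ʳ i) ≈ fromℕ (T i)) →
      fromℕ (totalPairCost 1 (tabulate T)) ≤ fromℕ 2 * (fromℕ m * totalCompletionTime I S)
    totalPairCost≤ σ T decreasing sorted types = begin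
      fromℕ (totalPairCost 1 (tabulate T))
        ≡⟨ cong fromℕ (totalPairCost-tabulate 1 T) ⟩
      fromℕ (ListAction.sum (tabulate λ i → ListAction.sum (tabulate λ j → pairCost 1 (T i) (T j))))
        ≈⟨ sym (sum-fromℕ {N} _) ⟩
      sum (λ i → fromℕ (ListAction.sum (tabulate λ j → pairCost 1 (T i) (T j))))
        ≈⟨ sum-cong-≋ {N} (λ i → sym (sum-fromℕ {N} _)) ⟩
      sum (λ i → sum (λ j → fromℕ (pairCost 1 (T i) (T j))))
        ≤⟨ sum-mono (λ i → sum-mono (λ j → pairCost≤pairWork unit (types i) (types j) first first)) ⟩
      sum (λ i → sum (λ j → pairWork unit (σ ⟨$⟩ʳ i) (σ ⟨$⟩ʳ j)))
        ≈⟨ sum-cong-≋ (λ i → sym (sum-permute (pairWork unit (σ ⟨$⟩ʳ i)) σ)) ⟩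
      sum (λ i → sum (pairWork unit (σ ⟨$⟩ʳ i)))
        ≈⟨ sym (sum-permute (λ j → sum (pairWork unit j)) σ) ⟩
      sum (λ j → sum (pairWork unit j))
        ≤⟨ sum-pairWork unit ⟩
      fromℕ 2 * (fromℕ m * totalCompletionTime I S) ∎
      where
        -- Types decrease along the test order, so a strictly larger type sits at an earlier
        -- position and its test completes no later.
        first : ∀ {i j} → T j ℕ.< T i → C (τ (σ ⟨$⟩ʳ i)) ≤ C (τ (σ ⟨$⟩ʳ j))
        first {i} {j} Tj<Ti with <ᶠ-cmp i j
        ... | tri< i<j _ _    = sorted i<j
        ... | tri≈ _ ≡.refl _ = ≤-refl
        ... | tri> _ _ j<i    = contradiction Tj<Ti (ℕ.≤⇒≯ (AllPairs-tabulate⁻ decreasing j<i))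

  -- Shortest processing time first: position i of the decreasing order runs as
  -- the quotient-th last job on machine number remainder.
  module SPT {m n} {I : Instance (n ℕ.* m)} (unit : ∀ j → testTime I j ≈ 1#)
             (σ : Permutation′ (n ℕ.* m)) (t : Fin n → ℕ)
             (types : ∀ i → procTime I (σ ⟨$⟩ʳ i) ≈ fromℕ (t (quotient m i))) where

    level : Fin (n ℕ.* m) → Fin n
    level j = quotient m (σ ⟨$⟩ˡ j)

    track : Fin (n ℕ.* m) → Fin m
    track j = remainder {n} m (σ ⟨$⟩ˡ j)

    position-injective : ∀ {j k} → level j ≡ level k → track j ≡ track k → j ≡ k
    position-injective {j} {k} l r = ≡.trans (≡.sym (inverseʳ σ)) (≡.trans (cong (σ ⟨$⟩ʳ_)
      (≡.trans (≡.sym (combine-remQuot {n} m (σ ⟨$⟩ˡ j))) (≡.trans (cong₂ combine l r)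
        (combine-remQuot {n} m (σ ⟨$⟩ˡ k))))) (inverseʳ σ))

    spt : Schedule m (n ℕ.* m)
    spt = record
      { start   = λ { (τ j) → fromℕ (startTime t (level j))
                    ; (π j) → 1# + fromℕ (startTime t (level j)) }
      ; machine = λ { (τ j) → track j ; (π j) → track j } }

    procTime≈ : ∀ j → procTime I j ≈ fromℕ (t (level j))
    procTime≈ j = trans (reflexive (cong (procTime I) (≡.sym (inverseʳ σ)))) (types (σ ⟨$⟩ˡ j))

    job : Op (n ℕ.* m) → Fin (n ℕ.* m)
    job (τ j) = j
    job (π j) = j

    completion-τ : ∀ j → completion I spt (τ j) ≈ start spt (π j)
    completion-τ j = trans (+-congˡ (unit j)) (+-comm _ 1#)

    completion-π : ∀ j → completion I spt (π j) ≈ fromℕ (endTime t (level j))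
    completion-π j = begin-equality
      1# + fromℕ (startTime t (level j)) + procTime I j
        ≈⟨ +-cong (+-comm 1# _) (procTime≈ j) ⟩
      fromℕ (startTime t (level j)) + 1# + fromℕ (t (level j))
        ≈⟨ +-assoc _ 1# _ ⟩
      fromℕ (startTime t (level j)) + fromℕ (suc (t (level j)))
        ≈⟨ sym (fromℕ-+ (startTime t (level j)) _) ⟩
      fromℕ (endTime t (level j)) ∎

    start≥ : ∀ o → fromℕ (startTime t (level (job o))) ≤ start spt o
    start≥ (τ j) = ≤-refl
    start≥ (π j) = x≤y+x 0≤1

    completion≤ : ∀ o → completion I spt o ≤ fromℕ (endTime t (level (job o)))
    completion≤ (π j) = ≤-reflexive (completion-π j)
    completion≤ (τ j) = begin
      completion I spt (τ j)        ≈⟨ completion-τ j ⟩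
      start spt (π j)               ≤⟨ x≤x+y (procTime≥0 I j) ⟩
      completion I spt (π j)        ≈⟨ completion-π j ⟩
      fromℕ (endTime t (level j))   ∎

    earlier : ∀ {o o′} → level (job o′) Fin.< level (job o) → completion I spt o ≤ start spt o′
    earlier {o} {o′} l = ≤-trans (completion≤ o) (≤-trans (fromℕ-mono (endTime≤startTime t l)) (start≥ o′))

    machine≡track : ∀ o → machine spt o ≡ track (job o)
    machine≡track (τ j) = ≡.refl
    machine≡track (π j) = ≡.refl

    sameJob : ∀ {o o′} → o ≢ o′ → job o ≡ job o′ →
              completion I spt o ≤ start spt o′ ⊎ completion I spt o′ ≤ start spt o
    sameJob {τ j} {τ _} o≢ ≡.refl = contradiction ≡.refl o≢
    sameJob {τ j} {π _} o≢ ≡.refl = inj₁ (≤-reflexive (completion-τ j))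
    sameJob {π j} {τ _} o≢ ≡.refl = inj₂ (≤-reflexive (completion-τ j))
    sameJob {π j} {π _} o≢ ≡.refl = contradiction ≡.refl o≢

    spt-feasible : Feasible I spt
    spt-feasible = record
      { start≥0   = λ o → ≤-trans (0≤fromℕ (startTime t (level (job o)))) (start≥ o)
      ; testFirst = λ j → ≤-reflexive (completion-τ j)
      ; noOverlap = noOverlap }
      where
        noOverlap : ∀ {o o′} → o ≢ o′ → machine spt o ≡ machine spt o′ →
                    completion I spt o ≤ start spt o′ ⊎ completion I spt o′ ≤ start spt o
        noOverlap {o} {o′} o≢ same with <ᶠ-cmp (level (job o)) (level (job o′))
        ... | tri< l _ _ = inj₂ (earlier {o′} {o} l)
        ... | tri≈ _ l _ = sameJob o≢ (position-injective l
          (≡.trans (≡.sym (machine≡track o)) (≡.trans same (machine≡track o′))))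
        ... | tri> _ _ l = inj₁ (earlier {o} {o′} l)

    spt-cost : totalCompletionTime I spt ≈ fromℕ (m ℕ.* ListAction.sum (tabulate (endTime t)))
    spt-cost = begin-equality
      sum (λ j → completion I spt (π j))
        ≈⟨ sum-cong-≋ completion-π ⟩
      sum (λ j → fromℕ (endTime t (level j)))
        ≈⟨ sum-permute _ σ ⟩
      sum (λ i → fromℕ (endTime t (level (σ ⟨$⟩ʳ i))))
        ≈⟨ sum-cong-≋ {n ℕ.* m} (λ i → reflexive (cong (fromℕ ∘ endTime t ∘ quotient m) (inverseˡ σ {i}))) ⟩
      sum (λ i → fromℕ (endTime t (quotient m i)))
        ≈⟨ sum-fromℕ {n ℕ.* m} _ ⟩
      fromℕ (ListAction.sum (tabulate (endTime t ∘ quotient m)))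
        ≡⟨ cong fromℕ (≡.trans (cong ListAction.sum (tabulate-quotient m (endTime t))) (sum-concatMap-replicate m (tabulate (endTime t)))) ⟩
      fromℕ (m ℕ.* ListAction.sum (tabulate (endTime t))) ∎

  module _ {m q K} {I : Instance (q ℕ.* 2 ℕ.^ K ℕ.* m)} {A : OnlineAlgorithm m} where

    private
      n = q ℕ.* 2 ℕ.^ K
      P = numer K
      R = denom K

    module Bounds (1≤m : 1 ℕ.≤ m) (outcome : DyadicOutcome A K I) where

      open DyadicOutcome outcome

      instance
        m≢0 : ℕ.NonZero m
        m≢0 = ℕ.>-nonZero 1≤m

      private
        S = schedule A I

        -- `t` lists the n types that one machine receives in the reference schedule, while `T`
        -- below lists all n m types in test order.
        t,≡ = ≡-tabulate (ladder K q) (length-ladder K q)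
        t = proj₁ t,≡

        T : Fin (n ℕ.* m) → ℕ
        T = t ∘ quotient m

        dyadicTypes≡ : dyadicTypes K (n ℕ.* m) ≡ ladder K (q ℕ.* m)
        dyadicTypes≡ = ≡.trans (cong (dyadicTypes K) (swap q (2 ℕ.^ K) m)) (dyadicTypes≡ladder K (q ℕ.* m))
          where
            swap : ∀ q e m → q ℕ.* e ℕ.* m ≡ q ℕ.* m ℕ.* e
            swap = solve-∀

        ladder≡T : ladder K (q ℕ.* m) ≡ tabulate T
        ladder≡T = ≡.trans (ladder-* K q m) (≡.trans (cong (concatMap (replicate m)) (proj₂ t,≡))
          (≡.sym (tabulate-quotient m t)))

        σ,≡ = ↭-allFin⇒permutation allJobs
        σ = proj₁ σ,≡

        procTime≈T : ∀ i → procTime I (σ ⟨$⟩ʳ i) ≈ fromℕ (T i)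
        procTime≈T = Pointwise.tabulate⁻ (≡.subst₂ (Pointwise _) (proj₂ σ,≡) (≡.trans dyadicTypes≡ ladder≡T) types)

        open SPT {m} {n} {I} unitTests σ t procTime≈T using (spt; spt-feasible; spt-cost)

      -- The pair sum over the whole family is proportional to (q m)². The load bound uses up one
      -- factor m, and the other matches the m identical machines in `OPT-upper`.
      ALG-lower : fromℕ P * (fromℕ q * fromℕ q) * fromℕ m ≤ fromℕ 2 * ALG A I
      ALG-lower = *-cancelˡ-≤ (0<fromℕ m) (begin
        fromℕ m * (fromℕ P * (fromℕ q * fromℕ q) * fromℕ m)
          ≈⟨ solve 3 (λ m p q → m :* (p :* (q :* q) :* m) := p :* ((q :* m) :* (q :* m))) refl (fromℕ m) (fromℕ P) (fromℕ q) ⟩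
        fromℕ P * (fromℕ q * fromℕ m * (fromℕ q * fromℕ m))
          ≈⟨ *-congˡ (*-cong (sym (fromℕ-* q m)) (sym (fromℕ-* q m))) ⟩
        fromℕ P * (fromℕ (q ℕ.* m) * fromℕ (q ℕ.* m))
          ≈⟨ sym (trans (fromℕ-* P _) (*-congˡ (fromℕ-* (q ℕ.* m) _))) ⟩
        fromℕ (P ℕ.* (q ℕ.* m ℕ.* (q ℕ.* m)))
          ≡⟨ cong fromℕ (≡.trans (≡.sym (totalPairCost₁-ladder K (q ℕ.* m))) (cong (totalPairCost 1) ladder≡T)) ⟩
        fromℕ (totalPairCost 1 (tabulate T))
          ≤⟨ totalPairCost≤ (feasible A I) unitTests σ T
               (subst (AllPairs ℕ._≥_) ladder≡T (sorted-ladder K (q ℕ.* m)))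
               (AllPairs-tabulate⁻ (subst (AllPairs _) (proj₂ σ,≡) sorted)) procTime≈T ⟩
        fromℕ 2 * (fromℕ m * ALG A I)
          ≈⟨ solve 3 (λ d m a → d :* (m :* a) := m :* (d :* a)) refl (fromℕ 2) (fromℕ m) (ALG A I) ⟩
        fromℕ m * (fromℕ 2 * ALG A I) ∎)
        where open Solver

      OPT-upper : ∀ {opt} → IsOPT m I opt →
        fromℕ 6 * opt ≤ fromℕ m * (fromℕ R * (fromℕ q * fromℕ q) + fromℕ 6 * (fromℕ q * fromℕ (2 ℕ.^ K)))
      OPT-upper {opt} (_ , minimal) = begin
        fromℕ 6 * opt
          ≤⟨ *-monoʳ-≤ (0≤fromℕ 6) (minimal spt spt-feasible) ⟩
        fromℕ 6 * totalCompletionTime I spt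
          ≈⟨ *-congˡ (trans spt-cost (fromℕ-* m s)) ⟩
        fromℕ 6 * (fromℕ m * fromℕ s)
          ≈⟨ solve 3 (λ x m s → x :* (m :* s) := m :* (x :* s)) refl (fromℕ 6) (fromℕ m) (fromℕ s) ⟩
        fromℕ m * (fromℕ 6 * fromℕ s)
          ≈⟨ *-congˡ (sym (fromℕ-* 6 s)) ⟩
        fromℕ m * fromℕ (6 ℕ.* s)
          ≤⟨ *-monoʳ-≤ (0≤fromℕ m) (fromℕ-mono (6*sum-endTime K q t (proj₂ t,≡))) ⟩
        fromℕ m * fromℕ (R ℕ.* (q ℕ.* q) ℕ.+ 6 ℕ.* n)
          ≈⟨ *-congˡ (fromℕ-+ (R ℕ.* (q ℕ.* q)) (6 ℕ.* n)) ⟩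
        fromℕ m * (fromℕ (R ℕ.* (q ℕ.* q)) + fromℕ (6 ℕ.* n))
          ≈⟨ *-congˡ (+-cong (trans (fromℕ-* R (q ℕ.* q)) (*-congˡ (fromℕ-* q q)))
                             (trans (fromℕ-* 6 n) (*-congˡ (fromℕ-* q (2 ℕ.^ K))))) ⟩
        fromℕ m * (fromℕ R * (fromℕ q * fromℕ q) + fromℕ 6 * (fromℕ q * fromℕ (2 ℕ.^ K))) ∎
        where
          open Solver
          s = ListAction.sum (tabulate (endTime t))

      ratio-lower : ∀ {ε opt} → .{{ℕ.NonZero q}} → 0# < ε →
        fromℕ 18 * (fromℕ P * fromℕ (2 ℕ.^ K)) ≤ fromℕ q * ε →
        IsOPT m I opt → dyadicBound K - ε ≤ ALG A I ÷ opt
      ratio-lower {ε} {opt} {{q≢0}} 0<ε large isOPT@((S* , S*-feasible , S*≈opt) , _) =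
        x*y≤z⇒x≤z÷y 0<opt bound
        where
          instance
            N≢0 : ℕ.NonZero (n ℕ.* m)
            N≢0 = ℕ.m*n≢0 n m {{ℕ.m*n≢0 q (2 ℕ.^ K) {{q≢0}} {{ℕ.m^n≢0 2 K}}}}

          -- The optimum is attained by a feasible schedule, in which every job completes at time 1
          -- or later, so the division by it is meaningful.
          0<opt : 0# < opt
          0<opt = <-respʳ-≈ S*≈opt (0<totalCompletionTime S*-feasible unitTests)

          bound : (dyadicBound K - ε) * opt ≤ ALG A I
          -- `absorb-linear-term` multiplies the upper bound on the optimum by this difference and
          -- so requires its sign. If it is at most 0, the left side is at most 0 and the claim is
          -- immediate.
          bound with total 0# (dyadicBound K - ε)
          ... | inj₂ ≤0 = ≤-trans (≤-respʳ-≈ (zeroˡ opt) (*-monoˡ-≤ (proj₁ 0<opt) ≤0))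
                            (proj₁ (0<totalCompletionTime (feasible A I) unitTests))
          ... | inj₁ 0≤ = absorb-linear-term F (0≤fromℕ P) (x≤x+y (0≤fromℕ (2 ℕ.* P))) (0≤fromℕ m) (0≤fromℕ q)
                            (0≤fromℕ (2 ℕ.^ K)) (proj₁ 0<ε) 0≤ (denom*dyadicBound F K) large
                            ALG-lower (OPT-upper isOPT)

  dyadicRatio-liminf : ∀ m → 1 ℕ.≤ m → ∀ K (A : OnlineAlgorithm m) →
                       LiminfAtLeast (DyadicRatio A K) (dyadicBound K)
  dyadicRatio-liminf m 1≤m K A ε 0<ε
    with M , large ← archimedean-* (fromℕ 18 * (fromℕ (numer K) * fromℕ (2 ℕ.^ K))) 0<ε =
    -- With n = q 2^K this threshold says M < q: then q ε dominates the constant 18 P 2^K, which is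
    -- fixed once K is, and q is nonzero even when M is 0.
    suc M ℕ.* 2 ℕ.^ K , bound
    where
      bound : ∀ n → suc M ℕ.* 2 ℕ.^ K ℕ.≤ n → ∀ x → DyadicRatio A K n x → dyadicBound K - ε ≤ x
      bound _ n₀≤n x (divides q ≡.refl , I , outcome , opt , isOPT , x≈) =
        ≤-respʳ-≈ (sym x≈) (Bounds.ratio-lower {I = I} {A} 1≤m outcome {{ℕ.>-nonZero (ℕ.≤-trans (ℕ.s≤s ℕ.z≤n) M<q)}} 0<ε
          (≤-trans large (*-monoˡ-≤ (proj₁ 0<ε) (fromℕ-mono (ℕ.<⇒≤ M<q)))) isOPT)
        where
          M<q : M ℕ.< q
          M<q = ℕ.*-cancelʳ-≤ (suc M) q (2 ℕ.^ K) {{ℕ.m^n≢0 2 K}} n₀≤n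

open import Data.Nat using (ℕ; _≤_)

theorem4p4 : ∀ {c ℓ₁ ℓ₂} (F : ArchimedeanOrderedField c ℓ₁ ℓ₂) →
    let open ArchimedeanOrderedField F hiding (_≤_)
        open Scheduling F in
      (∀ (m : ℕ) → 1 ≤ m → ∀ (K : ℕ) → 2 ≤ K → (A : OnlineAlgorithm m) →
         LiminfAtLeast (DyadicRatio A K) (dyadicBound K))
      × TendsTo dyadicBound (fromℕ 3 ÷ fromℕ 2)
theorem4p4 F = (λ m 1≤m K _ → dyadicRatio-liminf F m 1≤m K) , dyadicBound-tendsTo F
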